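{- For every term $M$ of the Functional Machine Calculus the following are equivalent: 1. $M$ is strongly typeable, i.e. $\Gamma\vdash_s M:\tau$ for some typing context $\Gamma$ and computation type $\tau$; 2. $M$ is strongly normalizing with respect to reduction $\to$; 3. there is a perpetual evaluation $M\blacktriangleright \mathcal M$ for some normal form $\mathcal M$.
   Context: **Terms.** Fix a finite set $A$ of locations containing a default location $\lambda$, and infinitely many variables. Terms: $M,N,P ::= x \mid a\langle x\rangle.M \mid [N]a.M \mid \star \mid M;N$ (variable; abstraction/pop on $a\in A$, binding $x$ in $M$; application/push of $N$ on $a\in A$; unit; sequencing), taken up to $\alpha$-equivalence. $\{N/x\}M$ is capture-avoiding substitution, $\mathrm{fv}(N)$ the set of free variables. **Reduction.** Rules: (beta) $[N]a.a\langle x\rangle.M\to\{N/x\}M$; (passage) $[N]b.a\langle x\rangle.M\to a\langle x\rangle.[N]b.M$ if $a\ne b$, $x\notin\mathrm{fv}(N)$; (next) $\star;M\to M$; (prefix pop) $(a\langle x\rangle.N);M\to a\langle x\rangle.(N;M)$ if $x\notin\mathrm{fv}(M)$; (prefix push) $([P]a.N);M\to[P]a.(N;M)$; (associate) $(P;N);M\to P;(N;M)$. Reduction $\to$ is the closure of these rules under all term contexts. $M$ is strongly normalizing if there is no infinite $\to$-reduction from $M$. **Normal forms** of $\to$ are the terms $\mathcal M::=a\langle x\rangle.\mathcal M\mid\mathcal N$, where $\mathcal N::=[\mathcal M]a.\mathcal N\mid x;\mathcal M\mid x\mid\star$. **Perpetual evaluation** $M\blacktriangleright\mathcal M$ between terms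 and normal forms is defined inductively; below $H.M$ stands for $[N_1]a_1.\cdots[N_n]a_n.M$ for an arbitrary sequence of applications ($n\ge0$). (Beta) if $H.\{N/x\}M\blacktriangleright\mathcal M$ and $N\blacktriangleright\mathcal M'$ then $H.[N]a.a\langle x\rangle.M\blacktriangleright\mathcal M$; (Passage) if $H.a\langle x\rangle.[N]b.M\blacktriangleright\mathcal M$, $a\neq b$, $x\notin\mathrm{fv}(N)$, then $H.[N]b.a\langle x\rangle.M\blacktriangleright\mathcal M$; (Next) if $H.M\blacktriangleright\mathcal M$ then $H.(\star;M)\blacktriangleright\mathcal M$; (Prefix pop) if $H.a\langle x\rangle.(N;M)\blacktriangleright\mathcal M$, $x\notin\mathrm{fv}(M)$, then $H.((a\langle x\rangle.N);M)\blacktriangleright\mathcal M$; (Prefix push) if $H.[P]a.(N;M)\blacktriangleright\mathcal M$ then $H.(([P]a.N);M)\blacktriangleright\mathcal M$; (Associate) if $H.(P;(N;M))\blacktriangleright\mathcal M$ then $H.((P;N);M)\blacktriangleright\mathcal M$; (Normal abstraction) if $M\blacktriangleright\mathcal M$ then $a\langle x\rangle.M\blacktriangleright a\langle x\rangle.\mathcal M$; (Normal unit) if $N_i\blacktriangleright\mathcal M_i$ for all $i\le n$ then $[N_1]a_1.\cdots[N_n]a_n.\star\blacktriangleright[\mathcal M_1]a_1.\cdots[\mathcal M_n]a_n.\star$; (Normal variable) the same with $\star$ replaced by a variable $x$ on both sides; (Normal sequence) if $N_i\blacktriangleright\mathcal M_i$ for all $i\le n$ and $M\blacktriangleright\mathcal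 M$ then $[N_1]a_1.\cdots[N_n]a_n.(x;M)\blacktriangleright[\mathcal M_1]a_1.\cdots[\mathcal M_n]a_n.(x;\mathcal M)$. **Types.** Mutually inductively: computation types $\tau::=\vec I\Rightarrow\vec K$ with $\vec I,\vec K$ memory types; collection types $\iota::=[\tau_1,\dots,\tau_n]$ ($n\ge0$), finite multisets of computation types, with multiset union $\iota+\kappa$; vector types, finite sequences of collection types (last entry = top of stack); memory types, families of vector types indexed by $A$. $\vec K\cdot\iota_a$ is $\vec K$ with $\iota$ added on top at location $a$. A typing context $\Gamma$ is a finitely supported function from variables to collection types (default value $[]$); $\Gamma+\Delta$ is the pointwise sum; in $\Gamma,x:\iota$ it is understood that $\Gamma(x)=[]$. **Strong typing** $\Gamma\vdash_s M:\tau$ and $\Gamma\vdash_s M:\iota$: (variable) $x:[\tau]\vdash x:\tau$; (abstraction) from $\Gamma,x:\iota\vdash M:\vec K\Rightarrow\vec L$ infer $\Gamma\vdash a\langle x\rangle.M:\vec K\cdot\iota_a\Rightarrow\vec L$; (strong application) from $\Gamma\vdash N:\iota$, $\Delta\vdash M:\vec K\cdot\iota_a\Rightarrow\vec L$ and $E\vdash N:\tau$ (any computation type $\tau$) infer $\Gamma+\Delta+E\vdash[N]a.M:\vec K\Rightarrow\vec L$; (unit) $\vdash\star:\vec I\Rightarrow\vec I$; (sequencing) from $\Gamma\vdash N:\vec I\Rightarrow\vec K$ and $\Delta\vdash M:\vec K\Rightarrow\vec L$ infer $\Gamma+\Delta\vdash N;M:\vec I\Rightarrow\vec L$; (collection)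 from $\Gamma_i\vdash M:\tau_i$ for $1\le i\le n$ ($n\ge0$) infer $\Gamma_1+\dots+\Gamma_n\vdash M:[\tau_1,\dots,\tau_n]$; (weakening) from $\Gamma\vdash M:\tau$ infer $\Gamma+\Delta\vdash M:\tau$. -}

module Defs where

open import Axiom.ExcludedMiddle using (ExcludedMiddle)
open import Data.Bool using (if_then_else_)
open import Data.Fin as Fin using (Fin; zero; suc; lift)
open import Data.List using (List; []; _∷_; _++_; foldr)
open import Data.List.Relation.Binary.Permutation.Homogeneous using (Permutation)
open import Data.List.Relation.Binary.Pointwise using (Pointwise)
open import Data.Nat using (ℕ; zero; suc)
open import Data.Product using (Σ; ∃; ∃-syntax; ∃₂; _×_; _,_; proj₁; proj₂)
import Data.Vec.Functional as Vector
open import Function using (flip)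
open import Function.Bundles using (_↔_)
open import Function.Properties.Inverse using (↔⇒↣)
open import Induction.InfiniteDescent using (InfiniteDescendingSequenceFrom)
open import Induction.WellFounded using (Acc; acc)
open import Level using (0ℓ)
open import Relation.Binary using (DecidableEquality)
open import Relation.Binary.PropositionalEquality using (_≡_; _≢_; refl; subst)
open import Relation.Nullary using (¬_; yes; no; does; contradiction)
open import Relation.Nullary.Decidable using (via-injection)

record Locations : Set₁ where
  field
    Location : Set
    size     : ℕ
    finite   : Location ↔ Fin size
    default  : Location

  infix 4 _≟_
  _≟_ : DecidableEquality Location
  _≟_ = via-injection (↔⇒↣ finite) Fin._≟_

module FMC (A : Locations) where

  open Locations A public

  -- Terms up to α-equivalence, as well-scoped de Bruijn terms whose free
  -- variables are among n variables.  Side conditions x ∉ fv(N) turn into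
  -- weakenings of N.

  infixr 6 _⟨⟩∙_ [_]_∙_
  infixr 5 _⨾_

  data Term (n : ℕ) : Set where
    var    : Fin n → Term n
    _⟨⟩∙_  : Location → Term (suc n) → Term n
    [_]_∙_ : Term n → Location → Term n → Term n
    ⋆      : Term n
    _⨾_    : Term n → Term n → Term n

  rename : ∀ {m n} → (Fin m → Fin n) → Term m → Term n
  rename ρ (var x)       = var (ρ x)
  rename ρ (a ⟨⟩∙ M)     = a ⟨⟩∙ rename (lift 1 ρ) M
  rename ρ ([ N ] a ∙ M) = [ rename ρ N ] a ∙ rename ρ M
  rename ρ ⋆             = ⋆
  rename ρ (M ⨾ N)       = rename ρ M ⨾ rename ρ N

  weaken : ∀ {n} → Term n → Term (suc n)
  weaken = rename suc

  liftₛ : ∀ {m n} → (Fin m → Term n) → Fin (suc m) → Term (suc n)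
  liftₛ σ zero    = var zero
  liftₛ σ (suc x) = weaken (σ x)

  substitute : ∀ {m n} → (Fin m → Term n) → Term m → Term n
  substitute σ (var x)       = σ x
  substitute σ (a ⟨⟩∙ M)     = a ⟨⟩∙ substitute (liftₛ σ) M
  substitute σ ([ N ] a ∙ M) = [ substitute σ N ] a ∙ substitute σ M
  substitute σ ⋆             = ⋆
  substitute σ (M ⨾ N)       = substitute σ M ⨾ substitute σ N

  -- ⟪ N ⟫ M is {N/x}M, where x is the variable bound last (index zero).
  ⟪_⟫_ : ∀ {n} → Term n → Term (suc n) → Term n
  ⟪ N ⟫ M = substitute (N Vector.∷ var) M

  infix 4 _⟶_

  data _⟶_ {n : ℕ} : Term n → Term n → Set where
    beta        : ∀ {N a M} → [ N ] a ∙ (a ⟨⟩∙ M) ⟶ ⟪ N ⟫ M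
    passage     : ∀ {N a b M} → a ≢ b →
                  [ N ] b ∙ (a ⟨⟩∙ M) ⟶ a ⟨⟩∙ ([ weaken N ] b ∙ M)
    next        : ∀ {M} → ⋆ ⨾ M ⟶ M
    prefix-pop  : ∀ {a N M} → (a ⟨⟩∙ N) ⨾ M ⟶ a ⟨⟩∙ (N ⨾ weaken M)
    prefix-push : ∀ {P a N M} → ([ P ] a ∙ N) ⨾ M ⟶ [ P ] a ∙ (N ⨾ M)
    associate   : ∀ {P N M} → (P ⨾ N) ⨾ M ⟶ P ⨾ (N ⨾ M)
    in-pop      : ∀ {a} {M M′ : Term (suc n)} → M ⟶ M′ → a ⟨⟩∙ M ⟶ a ⟨⟩∙ M′
    in-arg      : ∀ {N N′ a M} → N ⟶ N′ → [ N ] a ∙ M ⟶ [ N′ ] a ∙ M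
    in-push     : ∀ {N a M M′} → M ⟶ M′ → [ N ] a ∙ M ⟶ [ N ] a ∙ M′
    in-seqˡ     : ∀ {N N′ M} → N ⟶ N′ → N ⨾ M ⟶ N′ ⨾ M
    in-seqʳ     : ∀ {N M M′} → M ⟶ M′ → N ⨾ M ⟶ N ⨾ M′

  -- Strong normalization as accessibility, the pointwise form of
  -- Relation.Binary.Rewriting.StronglyNormalizing.  It implies the absence
  -- of infinite reductions, and is equivalent to it under excluded middle;
  -- both facts are proved below.
  StronglyNormalizing : ∀ {n} → Term n → Set
  StronglyNormalizing = Acc (flip _⟶_)

  NoInfiniteReduction : ∀ {n} → Term n → Set
  NoInfiniteReduction M = ¬ (∃[ f ] InfiniteDescendingSequenceFrom (flip _⟶_) f M)

  SN⇒noInfiniteReduction : ∀ {n} {M : Term n} →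
                           StronglyNormalizing M → NoInfiniteReduction M
  SN⇒noInfiniteReduction (acc rs) (f , refl , steps) =
    SN⇒noInfiniteReduction (rs (steps 0))
      ((λ i → f (suc i)) , refl , (λ i → steps (suc i)))

  noInfiniteReduction⇒SN : ExcludedMiddle 0ℓ → ∀ {n} {M : Term n} →
                           NoInfiniteReduction M → StronglyNormalizing M
  noInfiniteReduction⇒SN em {n} {M} ¬inf with em {StronglyNormalizing M}
  ... | yes sn = sn
  ... | no ¬sn = contradiction ((λ i → proj₁ (path i)) , refl , steps) ¬inf
    where
    Bad : Set
    Bad = Σ (Term n) λ P → ¬ StronglyNormalizing P

    badReduct : (b : Bad) → Σ Bad λ c → proj₁ b ⟶ proj₁ c
    badReduct (P , ¬snP) with em {Σ Bad λ c → P ⟶ proj₁ c}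
    ... | yes found = found
    ... | no none   = contradiction (acc snReduct) ¬snP
      where
      snReduct : ∀ {Q} → P ⟶ Q → StronglyNormalizing Q
      snReduct {Q} P⟶Q with em {StronglyNormalizing Q}
      ... | yes snQ = snQ
      ... | no ¬snQ = contradiction ((Q , ¬snQ) , P⟶Q) none

    path : ℕ → Bad
    path zero    = M , ¬sn
    path (suc i) = proj₁ (badReduct (path i))

    steps : ∀ i → proj₁ (path i) ⟶ proj₁ (path (suc i))
    steps i = proj₂ (badReduct (path i))

  data Normal  {n : ℕ} : Term n → Set
  data Neutral {n : ℕ} : Term n → Set

  data Normal {n} where
    pop     : ∀ {a} {M : Term (suc n)} → Normal M → Normal (a ⟨⟩∙ M)
    neutral : ∀ {M} → Neutral M → Normal M

  data Neutral {n} where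
    push : ∀ {M a N} → Normal M → Neutral N → Neutral ([ M ] a ∙ N)
    seq  : ∀ {x M} → Normal M → Neutral (var x ⨾ M)
    var  : ∀ {x} → Neutral (var x)
    unit : Neutral ⋆

  Pushes : ℕ → Set
  Pushes n = List (Term n × Location)

  -- H ▷ M is H.M, the first element of H being the outermost application.
  infixr 4 _▷_
  _▷_ : ∀ {n} → Pushes n → Term n → Term n
  H ▷ M = foldr (λ (N , a) P → [ N ] a ∙ P) M H

  -- Only the evaluation rules are given here: that the right-hand term is a
  -- normal form is imposed separately, in PerpetuallyEvaluates.
  infix 3 _▶_ _▶*_

  data _▶_  {n : ℕ} : Term n → Term n → Set
  data _▶*_ {n : ℕ} : Pushes n → Pushes n → Set

  data _▶_ {n} where
    beta        : ∀ {H N a M 𝓜 𝓜′} → (H ▷ ⟪ N ⟫ M) ▶ 𝓜 → N ▶ 𝓜′ →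
                  (H ▷ [ N ] a ∙ (a ⟨⟩∙ M)) ▶ 𝓜
    passage     : ∀ {H N a b M 𝓜} → a ≢ b →
                  (H ▷ a ⟨⟩∙ ([ weaken N ] b ∙ M)) ▶ 𝓜 →
                  (H ▷ [ N ] b ∙ (a ⟨⟩∙ M)) ▶ 𝓜
    next        : ∀ {H M 𝓜} → (H ▷ M) ▶ 𝓜 → (H ▷ ⋆ ⨾ M) ▶ 𝓜
    prefix-pop  : ∀ {H a N M 𝓜} → (H ▷ a ⟨⟩∙ (N ⨾ weaken M)) ▶ 𝓜 →
                  (H ▷ (a ⟨⟩∙ N) ⨾ M) ▶ 𝓜
    prefix-push : ∀ {H P a N M 𝓜} → (H ▷ [ P ] a ∙ (N ⨾ M)) ▶ 𝓜 →
                  (H ▷ ([ P ] a ∙ N) ⨾ M) ▶ 𝓜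
    associate   : ∀ {H P N M 𝓜} → (H ▷ P ⨾ (N ⨾ M)) ▶ 𝓜 →
                  (H ▷ (P ⨾ N) ⨾ M) ▶ 𝓜
    normal-pop  : ∀ {a} {M 𝓜 : Term (suc n)} → M ▶ 𝓜 → a ⟨⟩∙ M ▶ a ⟨⟩∙ 𝓜
    normal-unit : ∀ {H 𝓗} → H ▶* 𝓗 → (H ▷ ⋆) ▶ (𝓗 ▷ ⋆)
    normal-var  : ∀ {H 𝓗 x} → H ▶* 𝓗 → (H ▷ var x) ▶ (𝓗 ▷ var x)
    normal-seq  : ∀ {H 𝓗 x M 𝓜} → H ▶* 𝓗 → M ▶ 𝓜 →
                  (H ▷ var x ⨾ M) ▶ (𝓗 ▷ var x ⨾ 𝓜)

  data _▶*_ {n} where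
    []  : [] ▶* []
    _∷_ : ∀ {N 𝓜 a H 𝓗} → N ▶ 𝓜 → H ▶* 𝓗 → (N , a) ∷ H ▶* (𝓜 , a) ∷ 𝓗

  PerpetuallyEvaluates : ∀ {n} → Term n → Set
  PerpetuallyEvaluates M = ∃[ 𝓜 ] Normal 𝓜 × M ▶ 𝓜

  -- Collection types are lists read as multisets; vector types are lists with
  -- the top of the stack at the head.  The intended equality of types is ≈,
  -- which identifies collections up to permutation at every depth.

  infix 6 _⇒_

  data Computation : Set where
    _⇒_ : (I K : Location → List (List Computation)) → Computation

  Collection VectorType Memory : Set
  Collection = List Computation
  VectorType = List Collection
  Memory     = Location → VectorType

  infix 4 _≈_

  data _≈_ : Computation → Computation → Set where
    _⇒_ : ∀ {I I′ K K′ : Memory} →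
          (∀ a → Pointwise (Permutation _≈_) (I a) (I′ a)) →
          (∀ a → Pointwise (Permutation _≈_) (K a) (K′ a)) →
          I ⇒ K ≈ I′ ⇒ K′

  infix 4 _≈ᶜ_
  _≈ᶜ_ : Collection → Collection → Set
  _≈ᶜ_ = Permutation _≈_

  infixl 7 _·_at_
  _·_at_ : Memory → Collection → Location → Memory
  (K · ι at a) b = if does (a ≟ b) then ι ∷ K b else K b

  Context : ℕ → Set
  Context n = Fin n → Collection

  ∅ : ∀ {n} → Context n
  ∅ _ = []

  _↦_ : ∀ {n} → Fin n → Computation → Context n
  (x ↦ τ) y = if does (x Fin.≟ y) then τ ∷ [] else []

  infixl 6 _⊕_
  _⊕_ : ∀ {n} → Context n → Context n → Context n
  (Γ ⊕ Δ) x = Γ x ++ Δ x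

  infixl 5 _▹_
  _▹_ : ∀ {n} → Context n → Collection → Context (suc n)
  Γ ▹ ι = ι Vector.∷ Γ

  infix 3 _⊢ₛ_∶_ _⊢ₛᶜ_∶_

  data _⊢ₛ_∶_  {n : ℕ} : Context n → Term n → Computation → Set
  data _⊢ₛᶜ_∶_ {n : ℕ} : Context n → Term n → Collection → Set

  -- The rules conv express that types are taken up to ≈.
  data _⊢ₛ_∶_ {n} where
    variable′          : ∀ {x τ} → x ↦ τ ⊢ₛ var x ∶ τ
    abstraction        : ∀ {Γ ι a M K L} → Γ ▹ ι ⊢ₛ M ∶ K ⇒ L →
                         Γ ⊢ₛ a ⟨⟩∙ M ∶ (K · ι at a) ⇒ L
    strong-application : ∀ {Γ Δ E N ι a M K L τ} → Γ ⊢ₛᶜ N ∶ ι →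
                         Δ ⊢ₛ M ∶ (K · ι at a) ⇒ L → E ⊢ₛ N ∶ τ →
                         Γ ⊕ Δ ⊕ E ⊢ₛ [ N ] a ∙ M ∶ K ⇒ L
    unit               : ∀ {I} → ∅ ⊢ₛ ⋆ ∶ I ⇒ I
    sequencing         : ∀ {Γ Δ N M I K L} → Γ ⊢ₛ N ∶ I ⇒ K → Δ ⊢ₛ M ∶ K ⇒ L →
                         Γ ⊕ Δ ⊢ₛ N ⨾ M ∶ I ⇒ L
    weakening          : ∀ {Γ Δ M τ} → Γ ⊢ₛ M ∶ τ → Γ ⊕ Δ ⊢ₛ M ∶ τ
    conv               : ∀ {Γ Γ′ M τ τ′} → (∀ x → Γ x ≈ᶜ Γ′ x) → τ ≈ τ′ →
                         Γ ⊢ₛ M ∶ τ → Γ′ ⊢ₛ M ∶ τ′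

  -- The n-ary collection rule, presented one premise at a time.
  data _⊢ₛᶜ_∶_ {n} where
    []   : ∀ {M} → ∅ ⊢ₛᶜ M ∶ []
    _∷_  : ∀ {Γ Δ M τ ι} → Γ ⊢ₛ M ∶ τ → Δ ⊢ₛᶜ M ∶ ι → Γ ⊕ Δ ⊢ₛᶜ M ∶ τ ∷ ι
    conv : ∀ {Γ Γ′ M ι ι′} → (∀ x → Γ x ≈ᶜ Γ′ x) → ι ≈ᶜ ι′ →
           Γ ⊢ₛᶜ M ∶ ι → Γ′ ⊢ₛᶜ M ∶ ι′

  StronglyTypeable : ∀ {n} → Term n → Set
  StronglyTypeable M = ∃₂ λ Γ τ → Γ ⊢ₛ M ∶ τ

{-# OPTIONS --safe #-}
module Submission where

-- Typeable ⇒ SN is a reducibility argument by orthogonality, where a type I ⇒ K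
-- relates stacks to continuations.  It rests on expansion lemmas for SN.  All
-- rules but beta are confluent and terminating, with a structurally computable
-- normal form nf; reducing M either preserves nf M and decreases a weight, or
-- properly reduces nf M.  Hence SN only depends on nf, and can be pulled back
-- along these rules anywhere in a term; only beta needs a separate argument.
--
-- SN ⇒ evaluation is an induction on reducts and subterms.
--
-- Evaluation ⇒ typeable is subject expansion: every head normal form can be typed
-- with its arguments at the empty collection, and every evaluation rule can be
-- inverted on typings.  For beta, each occurrence of N in {N/x}M contributes its
-- type to the collection of x, and the premise on N supplies the extra typing of
-- N that is required when there is no occurrence.

open import Defs
open import Algebra.Bundles using (CommutativeMonoid)
import Algebra.Properties.CommutativeSemigroup as CommutativeSemigroupProperties
open import Data.Bool using (if_then_else_; true; false)
open import Data.Fin as Fin using (Fin; zero; suc; lift)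
open import Data.List using (List; []; _∷_; _++_)
open import Data.List.Relation.Binary.Permutation.Homogeneous using (Permutation)
import Data.List.Relation.Binary.Permutation.Setoid as PermutationSetoid
import Data.List.Relation.Binary.Permutation.Setoid.Properties as PermutationProperties
open import Data.List.Relation.Binary.Pointwise as Pointwise using (Pointwise; []; _∷_)
open import Data.List.Relation.Unary.All using (All; []; _∷_)
open import Data.Nat using (ℕ; zero; suc; _+_; _*_; _<_; s≤s; z<s; >-nonZero)
open import Data.Nat.Induction using (<-wellFounded)
import Data.Nat.Properties as ℕ
open import Data.Product using (∃; ∃₂; _×_; _,_; proj₁; proj₂)
open import Data.Product.Function.NonDependent.Propositional using (_×-⇔_)
open import Data.Sum using (_⊎_; inj₁; inj₂; [_,_]′)
open import Data.Unit using (⊤)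
import Data.Vec.Functional as Vector
open import Function using (_∘_)
open import Function.Bundles using (_⇔_; mk⇔; module Equivalence)
open import Function.Construct.Composition using (_⇔-∘_)
open import Function.Construct.Identity using (⇔-id)
open import Induction.WellFounded using (Acc; acc)
open import Level using (0ℓ)
open import Relation.Binary using (Setoid)
open import Relation.Binary.Construct.Closure.ReflexiveTransitive
  using (Star; ε; _◅_; _◅◅_; gmap)
open import Relation.Binary.PropositionalEquality
  using (_≡_; _≢_; refl; sym; trans; cong; cong₂; subst; subst₂; module ≡-Reasoning)
open import Relation.Nullary using (yes; no; does; contradiction)
open import Relation.Nullary.Decidable using (dec-true; dec-false)

-- Substitution algebra, and strong normalization modulo the rules other than beta.

module Rewriting (A : Locations) where
  open FMC A
  open ≡-Reasoning

  private variable
    k m n   : ℕ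
    a b     : Location
    M M′ N N′ P P′ Q : Term n

  substitute-cong : {σ τ : Fin m → Term n} → (∀ x → σ x ≡ τ x) →
                    ∀ M → substitute σ M ≡ substitute τ M
  substitute-cong eq (var x)       = eq x
  substitute-cong eq (a ⟨⟩∙ M)     =
    cong (a ⟨⟩∙_) (substitute-cong (λ { zero → refl ; (suc x) → cong weaken (eq x) }) M)
  substitute-cong eq ([ N ] a ∙ M) =
    cong₂ ([_] a ∙_) (substitute-cong eq N) (substitute-cong eq M)
  substitute-cong eq ⋆             = refl
  substitute-cong eq (M ⨾ N)       = cong₂ _⨾_ (substitute-cong eq M) (substitute-cong eq N)

  substitute-var : (M : Term n) → substitute var M ≡ M
  substitute-var (var x)       = refl
  substitute-var (a ⟨⟩∙ M)     = cong (a ⟨⟩∙_)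
    (trans (substitute-cong (λ { zero → refl ; (suc x) → refl }) M) (substitute-var M))
  substitute-var ([ N ] a ∙ M) = cong₂ ([_] a ∙_) (substitute-var N) (substitute-var M)
  substitute-var ⋆             = refl
  substitute-var (M ⨾ N)       = cong₂ _⨾_ (substitute-var M) (substitute-var N)

  rename-as-substitute : (ρ : Fin m → Fin n) → ∀ M → rename ρ M ≡ substitute (var ∘ ρ) M
  rename-as-substitute ρ (var x)       = refl
  rename-as-substitute ρ (a ⟨⟩∙ M)     = cong (a ⟨⟩∙_)
    (trans (rename-as-substitute (lift 1 ρ) M)
           (substitute-cong (λ { zero → refl ; (suc x) → refl }) M))
  rename-as-substitute ρ ([ N ] a ∙ M) =
    cong₂ ([_] a ∙_) (rename-as-substitute ρ N) (rename-as-substitute ρ M)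
  rename-as-substitute ρ ⋆             = refl
  rename-as-substitute ρ (M ⨾ N)       =
    cong₂ _⨾_ (rename-as-substitute ρ M) (rename-as-substitute ρ N)

  substitute-rename : (σ : Fin m → Term n) (ρ : Fin k → Fin m) →
                      ∀ M → substitute σ (rename ρ M) ≡ substitute (σ ∘ ρ) M
  substitute-rename σ ρ (var x)       = refl
  substitute-rename σ ρ (a ⟨⟩∙ M)     = cong (a ⟨⟩∙_)
    (trans (substitute-rename (liftₛ σ) (lift 1 ρ) M)
           (substitute-cong (λ { zero → refl ; (suc x) → refl }) M))
  substitute-rename σ ρ ([ N ] a ∙ M) =
    cong₂ ([_] a ∙_) (substitute-rename σ ρ N) (substitute-rename σ ρ M)
  substitute-rename σ ρ ⋆             = refl
  substitute-rename σ ρ (M ⨾ N)       =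
    cong₂ _⨾_ (substitute-rename σ ρ M) (substitute-rename σ ρ N)

  rename-rename : (ρ : Fin m → Fin n) (θ : Fin k → Fin m) →
                  ∀ M → rename ρ (rename θ M) ≡ rename (ρ ∘ θ) M
  rename-rename ρ θ M = begin
    rename ρ (rename θ M)             ≡⟨ rename-as-substitute ρ _ ⟩
    substitute (var ∘ ρ) (rename θ M) ≡⟨ substitute-rename _ θ M ⟩
    substitute (var ∘ ρ ∘ θ) M        ≡⟨ rename-as-substitute _ M ⟨
    rename (ρ ∘ θ) M                  ∎

  rename-weaken : (ρ : Fin m → Fin n) → ∀ M →
                  rename (lift 1 ρ) (weaken M) ≡ weaken (rename ρ M)
  rename-weaken ρ M = trans (rename-rename _ suc M) (sym (rename-rename suc ρ M))

  rename-substitute : (ρ : Fin m → Fin n) (σ : Fin k → Term m) →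
                      ∀ M → rename ρ (substitute σ M) ≡ substitute (rename ρ ∘ σ) M
  rename-substitute ρ σ (var x)       = refl
  rename-substitute ρ σ (a ⟨⟩∙ M)     = cong (a ⟨⟩∙_)
    (trans (rename-substitute (lift 1 ρ) (liftₛ σ) M)
           (substitute-cong (λ { zero → refl ; (suc x) → rename-weaken ρ (σ x) }) M))
  rename-substitute ρ σ ([ N ] a ∙ M) =
    cong₂ ([_] a ∙_) (rename-substitute ρ σ N) (rename-substitute ρ σ M)
  rename-substitute ρ σ ⋆             = refl
  rename-substitute ρ σ (M ⨾ N)       =
    cong₂ _⨾_ (rename-substitute ρ σ M) (rename-substitute ρ σ N)

  substitute-weaken : (σ : Fin m → Term n) → ∀ M →
                      substitute (liftₛ σ) (weaken M) ≡ weaken (substitute σ M)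
  substitute-weaken σ M =
    trans (substitute-rename (liftₛ σ) suc M) (sym (rename-substitute suc σ M))

  substitute-substitute : (σ : Fin m → Term n) (τ : Fin k → Term m) → ∀ M →
    substitute σ (substitute τ M) ≡ substitute (substitute σ ∘ τ) M
  substitute-substitute σ τ (var x)       = refl
  substitute-substitute σ τ (a ⟨⟩∙ M)     = cong (a ⟨⟩∙_)
    (trans (substitute-substitute (liftₛ σ) (liftₛ τ) M)
           (substitute-cong (λ { zero → refl ; (suc x) → substitute-weaken σ (τ x) }) M))
  substitute-substitute σ τ ([ N ] a ∙ M) =
    cong₂ ([_] a ∙_) (substitute-substitute σ τ N) (substitute-substitute σ τ M)
  substitute-substitute σ τ ⋆             = refl
  substitute-substitute σ τ (M ⨾ N)       =
    cong₂ _⨾_ (substitute-substitute σ τ M) (substitute-substitute σ τ N)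

  ⟪⟫-weaken : (N M : Term n) → ⟪ N ⟫ (weaken M) ≡ M
  ⟪⟫-weaken N M = trans (substitute-rename _ suc M) (substitute-var M)

  ⟪⟫-liftₛ : (N : Term n) (σ : Fin m → Term n) → ∀ M →
             ⟪ N ⟫ (substitute (liftₛ σ) M) ≡ substitute (N Vector.∷ σ) M
  ⟪⟫-liftₛ N σ M = trans (substitute-substitute _ (liftₛ σ) M)
    (substitute-cong (λ { zero → refl ; (suc x) → ⟪⟫-weaken N (σ x) }) M)

  substitute-⟪⟫ : (σ : Fin m → Term n) → ∀ N M →
    substitute σ (⟪ N ⟫ M) ≡ ⟪ substitute σ N ⟫ (substitute (liftₛ σ) M)
  substitute-⟪⟫ σ N M = begin
    substitute σ (⟪ N ⟫ M)                            ≡⟨ substitute-substitute σ _ M ⟩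
    substitute (substitute σ ∘ (N Vector.∷ var)) M    ≡⟨ substitute-cong ext M ⟩
    substitute (substitute σ N Vector.∷ σ) M          ≡⟨ ⟪⟫-liftₛ _ σ M ⟨
    ⟪ substitute σ N ⟫ (substitute (liftₛ σ) M)       ∎
    where
    ext : ∀ x → substitute σ ((N Vector.∷ var) x) ≡ (substitute σ N Vector.∷ σ) x
    ext zero    = refl
    ext (suc x) = refl

  infix 4 _⟶*_ _⟶⁺_

  _⟶*_ _⟶⁺_ : Term n → Term n → Set
  _⟶*_ = Star _⟶_
  M ⟶⁺ P = ∃ λ N → M ⟶ N × N ⟶* P

  ⟶⁺⇒⟶* : M ⟶⁺ N → M ⟶* N
  ⟶⁺⇒⟶* (_ , r , rs) = r ◅ rs

  ⟶⁺-map : (f : Term m → Term n) → (∀ {M N} → M ⟶ N → f M ⟶ f N) → M ⟶⁺ N → f M ⟶⁺ f N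
  ⟶⁺-map f F (_ , r , rs) = _ , F r , gmap f F rs

  -- Unlike in `⟶⁺-map`, one step may become several, as `pushₙ` and `seqₙ` renormalize after it.
  ⟶⁺-bind : (f : Term m → Term n) → (∀ {M N} → M ⟶ N → f M ⟶⁺ f N) → M ⟶⁺ N → f M ⟶⁺ f N
  ⟶⁺-bind f F (_ , r , rs) with F r
  ... | _ , s , ss = _ , s , ss ◅◅ go rs
    where
    go : ∀ {M N} → M ⟶* N → f M ⟶* f N
    go ε        = ε
    go (r ◅ rs) = ⟶⁺⇒⟶* (F r) ◅◅ go rs

  *⁺-trans : M ⟶* N → N ⟶⁺ P → M ⟶⁺ P
  *⁺-trans ε        rs = rs
  *⁺-trans (r ◅ rs) ss = _ , r , rs ◅◅ ⟶⁺⇒⟶* ss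

  beta′ : ∀ {M P} → P ≡ ⟪ N ⟫ M → [ N ] a ∙ (a ⟨⟩∙ M) ⟶ P
  beta′ refl = beta

  passage′ : ∀ {M P} → a ≢ b → P ≡ weaken N → [ N ] b ∙ (a ⟨⟩∙ M) ⟶ a ⟨⟩∙ ([ P ] b ∙ M)
  passage′ a≢b refl = passage a≢b

  prefix-pop′ : ∀ {M P} → P ≡ weaken M → (a ⟨⟩∙ N) ⨾ M ⟶ a ⟨⟩∙ (N ⨾ P)
  prefix-pop′ refl = prefix-pop

  substitute-⟶ : (σ : Fin m → Term n) → M ⟶ N → substitute σ M ⟶ substitute σ N
  substitute-⟶ σ (beta {N} {M = M})  = beta′ (substitute-⟪⟫ σ N M)
  substitute-⟶ σ (passage {N} a≢b)   = passage′ a≢b (substitute-weaken σ N)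
  substitute-⟶ σ next                = next
  substitute-⟶ σ (prefix-pop {M = M}) = prefix-pop′ (substitute-weaken σ M)
  substitute-⟶ σ prefix-push         = prefix-push
  substitute-⟶ σ associate           = associate
  substitute-⟶ σ (in-pop r)          = in-pop (substitute-⟶ (liftₛ σ) r)
  substitute-⟶ σ (in-arg r)          = in-arg (substitute-⟶ σ r)
  substitute-⟶ σ (in-push r)         = in-push (substitute-⟶ σ r)
  substitute-⟶ σ (in-seqˡ r)         = in-seqˡ (substitute-⟶ σ r)
  substitute-⟶ σ (in-seqʳ r)         = in-seqʳ (substitute-⟶ σ r)

  rename-⟶ : (ρ : Fin m → Fin n) → M ⟶ N → rename ρ M ⟶ rename ρ N
  rename-⟶ {M = M} {N} ρ r
    rewrite rename-as-substitute ρ M | rename-as-substitute ρ N = substitute-⟶ _ r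

  substitute-⟶* : {σ τ : Fin m → Term n} → (∀ x → σ x ⟶* τ x) →
                  ∀ M → substitute σ M ⟶* substitute τ M
  substitute-⟶* rs (var x)       = rs x
  substitute-⟶* rs (a ⟨⟩∙ M)     = gmap _ in-pop
    (substitute-⟶* (λ { zero → ε ; (suc x) → gmap weaken (rename-⟶ suc) (rs x) }) M)
  substitute-⟶* rs ([ N ] a ∙ M) =
    gmap ([_] a ∙ _) in-arg (substitute-⟶* rs N) ◅◅ gmap ([ _ ] a ∙_) in-push (substitute-⟶* rs M)
  substitute-⟶* rs ⋆             = ε
  substitute-⟶* rs (M ⨾ N)       =
    gmap (_⨾ _) in-seqˡ (substitute-⟶* rs M) ◅◅ gmap (_ ⨾_) in-seqʳ (substitute-⟶* rs N)

  -- Normal forms for all rules except beta.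

  pushₙ : Term n → Location → Term n → Term n
  pushₙ N b (a ⟨⟩∙ M) with a ≟ b
  ... | yes _ = [ N ] b ∙ (a ⟨⟩∙ M)
  ... | no  _ = a ⟨⟩∙ pushₙ (weaken N) b M
  pushₙ N b (var x)       = [ N ] b ∙ var x
  pushₙ N b ([ P ] a ∙ M) = [ N ] b ∙ ([ P ] a ∙ M)
  pushₙ N b ⋆             = [ N ] b ∙ ⋆
  pushₙ N b (M ⨾ P)       = [ N ] b ∙ (M ⨾ P)

  -- Defined on arbitrary terms, distributing through the whole left component, so that the laws
  -- below are unconditional equations.
  seqₙ : Term n → Term n → Term n
  seqₙ (var x)       P = var x ⨾ P
  seqₙ (a ⟨⟩∙ M)     P = a ⟨⟩∙ seqₙ M (weaken P)
  seqₙ ([ N ] a ∙ M) P = pushₙ N a (seqₙ M P)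
  seqₙ ⋆             P = P
  seqₙ (M ⨾ Q)       P = seqₙ M (seqₙ Q P)

  nf : Term n → Term n
  nf (var x)       = var x
  nf (a ⟨⟩∙ M)     = a ⟨⟩∙ nf M
  nf ([ N ] a ∙ M) = pushₙ (nf N) a (nf M)
  nf ⋆             = ⋆
  nf (M ⨾ N)       = seqₙ (nf M) (nf N)

  rename-push : (ρ : Fin m → Fin n) → ∀ N a M →
                rename ρ (pushₙ N a M) ≡ pushₙ (rename ρ N) a (rename ρ M)
  rename-push ρ N b (a ⟨⟩∙ M) with a ≟ b
  ... | yes _ = refl
  ... | no  _ = cong (a ⟨⟩∙_) (trans (rename-push (lift 1 ρ) (weaken N) b M)
                  (cong (λ X → pushₙ X b (rename (lift 1 ρ) M)) (rename-weaken ρ N)))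
  rename-push ρ N b (var x)       = refl
  rename-push ρ N b ([ P ] a ∙ M) = refl
  rename-push ρ N b ⋆             = refl
  rename-push ρ N b (M ⨾ P)       = refl

  rename-seqₙ : (ρ : Fin m → Fin n) → ∀ M P →
                rename ρ (seqₙ M P) ≡ seqₙ (rename ρ M) (rename ρ P)
  rename-seqₙ ρ (var x)       P = refl
  rename-seqₙ ρ (a ⟨⟩∙ M)     P = cong (a ⟨⟩∙_) (trans (rename-seqₙ (lift 1 ρ) M (weaken P))
                                    (cong (seqₙ (rename (lift 1 ρ) M)) (rename-weaken ρ P)))
  rename-seqₙ ρ ([ N ] a ∙ M) P = trans (rename-push ρ N a (seqₙ M P))
                                    (cong (pushₙ _ a) (rename-seqₙ ρ M P))
  rename-seqₙ ρ ⋆             P = refl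
  rename-seqₙ ρ (M ⨾ Q)       P = trans (rename-seqₙ ρ M (seqₙ Q P))
                                    (cong (seqₙ (rename ρ M)) (rename-seqₙ ρ Q P))

  nf-rename : (ρ : Fin m → Fin n) → ∀ M → nf (rename ρ M) ≡ rename ρ (nf M)
  nf-rename ρ (var x)       = refl
  nf-rename ρ (a ⟨⟩∙ M)     = cong (a ⟨⟩∙_) (nf-rename (lift 1 ρ) M)
  nf-rename ρ ([ N ] a ∙ M) = trans (cong₂ (λ X → pushₙ X a) (nf-rename ρ N) (nf-rename ρ M))
                                (sym (rename-push ρ (nf N) a (nf M)))
  nf-rename ρ ⋆             = refl
  nf-rename ρ (M ⨾ N)       = trans (cong₂ seqₙ (nf-rename ρ M) (nf-rename ρ N))
                                (sym (rename-seqₙ ρ (nf M) (nf N)))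

  pushₙ-≢ : a ≢ b → (N : Term n) → ∀ M → pushₙ N b (a ⟨⟩∙ M) ≡ a ⟨⟩∙ pushₙ (weaken N) b M
  pushₙ-≢ {a} {b} a≢b N M with a ≟ b
  ... | yes a≡b = contradiction a≡b a≢b
  ... | no  _   = refl

  pushₙ-≡ : (N : Term n) → ∀ a M → pushₙ N a (a ⟨⟩∙ M) ≡ [ N ] a ∙ (a ⟨⟩∙ M)
  pushₙ-≡ N a M with a ≟ a
  ... | yes _   = refl
  ... | no  a≢a = contradiction refl a≢a

  seqₙ-push : (N : Term n) → ∀ a M P → seqₙ (pushₙ N a M) P ≡ pushₙ N a (seqₙ M P)
  seqₙ-push N b (a ⟨⟩∙ M) P with a ≟ b
  ... | yes refl = pushₙ-≡ N b _
  ... | no  a≢b = cong (a ⟨⟩∙_) (seqₙ-push (weaken N) b M (weaken P))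
  seqₙ-push N b (var x)       P = refl
  seqₙ-push N b ([ Q ] a ∙ M) P = refl
  seqₙ-push N b ⋆             P = refl
  seqₙ-push N b (M ⨾ Q)       P = refl

  seqₙ-assoc : (M Q P : Term n) → seqₙ (seqₙ M Q) P ≡ seqₙ M (seqₙ Q P)
  seqₙ-assoc (var x)       Q P = refl
  seqₙ-assoc (a ⟨⟩∙ M)     Q P = cong (a ⟨⟩∙_) (trans (seqₙ-assoc M (weaken Q) (weaken P))
                                  (cong (seqₙ M) (sym (rename-seqₙ suc Q P))))
  seqₙ-assoc ([ N ] a ∙ M) Q P = trans (seqₙ-push N a (seqₙ M Q) P)
                                   (cong (pushₙ N a) (seqₙ-assoc M Q P))
  seqₙ-assoc ⋆             Q P = refl
  seqₙ-assoc (M ⨾ M′)      Q P = trans (seqₙ-assoc M (seqₙ M′ Q) P)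
                                   (cong (seqₙ M) (seqₙ-assoc M′ Q P))

  -- Substitution can create redexes: a variable that stops the push may become a pop. The outer
  -- `nf` on the left accounts for them.
  nf-substitute-push : (σ : Fin m → Term n) → ∀ N a M →
    nf (substitute σ (pushₙ N a M)) ≡ pushₙ (nf (substitute σ N)) a (nf (substitute σ M))
  nf-substitute-push σ N b (a ⟨⟩∙ M) with a ≟ b
  ... | no a≢b = cong (a ⟨⟩∙_) (begin
        nf (substitute (liftₛ σ) (pushₙ (weaken N) b M))
          ≡⟨ nf-substitute-push (liftₛ σ) (weaken N) b M ⟩
        pushₙ (nf (substitute (liftₛ σ) (weaken N))) b (nf (substitute (liftₛ σ) M))
          ≡⟨ cong (λ X → pushₙ (nf X) b (nf (substitute (liftₛ σ) M))) (substitute-weaken σ N) ⟩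
        pushₙ (nf (weaken (substitute σ N))) b (nf (substitute (liftₛ σ) M))
          ≡⟨ cong (λ X → pushₙ X b (nf (substitute (liftₛ σ) M))) (nf-rename suc (substitute σ N)) ⟩
        pushₙ (weaken (nf (substitute σ N))) b (nf (substitute (liftₛ σ) M)) ∎)
  ... | yes refl = pushₙ-≡ _ a _
  nf-substitute-push σ N b (var x)       = refl
  nf-substitute-push σ N b ([ P ] a ∙ M) = refl
  nf-substitute-push σ N b ⋆             = refl
  nf-substitute-push σ N b (M ⨾ P)       = refl

  nf-substitute-seqₙ : (σ : Fin m → Term n) → ∀ M P →
    nf (substitute σ (seqₙ M P)) ≡ seqₙ (nf (substitute σ M)) (nf (substitute σ P))
  nf-substitute-seqₙ σ (var x)       P = refl
  nf-substitute-seqₙ σ (a ⟨⟩∙ M)     P = cong (a ⟨⟩∙_) (begin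
    nf (substitute (liftₛ σ) (seqₙ M (weaken P)))    ≡⟨ nf-substitute-seqₙ (liftₛ σ) M (weaken P) ⟩
    seqₙ σM (nf (substitute (liftₛ σ) (weaken P)))   ≡⟨ cong (seqₙ σM ∘ nf) (substitute-weaken σ P) ⟩
    seqₙ σM (nf (weaken (substitute σ P)))           ≡⟨ cong (seqₙ σM) (nf-rename suc (substitute σ P)) ⟩
    seqₙ σM (weaken (nf (substitute σ P)))           ∎)
    where σM = nf (substitute (liftₛ σ) M)
  nf-substitute-seqₙ σ ([ N ] a ∙ M) P = begin
    nf (substitute σ (pushₙ N a (seqₙ M P)))   ≡⟨ nf-substitute-push σ N a (seqₙ M P) ⟩
    pushₙ σN a (nf (substitute σ (seqₙ M P)))  ≡⟨ cong (pushₙ σN a) (nf-substitute-seqₙ σ M P) ⟩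
    pushₙ σN a (seqₙ σM σP)                    ≡⟨ seqₙ-push σN a σM σP ⟨
    seqₙ (pushₙ σN a σM) σP                    ∎
    where
    σM = nf (substitute σ M)
    σN = nf (substitute σ N)
    σP = nf (substitute σ P)
  nf-substitute-seqₙ σ ⋆             P = refl
  nf-substitute-seqₙ σ (M ⨾ Q)       P = begin
    nf (substitute σ (seqₙ M (seqₙ Q P)))      ≡⟨ nf-substitute-seqₙ σ M (seqₙ Q P) ⟩
    seqₙ σM (nf (substitute σ (seqₙ Q P)))     ≡⟨ cong (seqₙ σM) (nf-substitute-seqₙ σ Q P) ⟩
    seqₙ σM (seqₙ σQ σP)                       ≡⟨ seqₙ-assoc σM σQ σP ⟨
    seqₙ (seqₙ σM σQ) σP                       ∎
    where
    σM = nf (substitute σ M)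
    σQ = nf (substitute σ Q)
    σP = nf (substitute σ P)

  -- Allowing two substitutions that agree up to `nf` lets one induction yield both the idempotence
  -- of `nf` and its compatibility with beta.
  nf-substitute : {σ τ : Fin m → Term n} → (∀ x → nf (σ x) ≡ nf (τ x)) →
                  ∀ M → nf (substitute σ M) ≡ nf (substitute τ (nf M))
  nf-substitute eq (var x)       = eq x
  nf-substitute {σ = σ} {τ} eq (a ⟨⟩∙ M) = cong (a ⟨⟩∙_) (nf-substitute eq′ M)
    where
    eq′ : ∀ x → nf (liftₛ σ x) ≡ nf (liftₛ τ x)
    eq′ zero    = refl
    eq′ (suc x) = trans (nf-rename suc (σ x))
                    (trans (cong weaken (eq x)) (sym (nf-rename suc (τ x))))
  nf-substitute eq ([ N ] a ∙ M) =
    trans (cong₂ (λ X → pushₙ X a) (nf-substitute eq N) (nf-substitute eq M))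
          (sym (nf-substitute-push _ (nf N) a (nf M)))
  nf-substitute eq ⋆             = refl
  nf-substitute eq (M ⨾ N)       =
    trans (cong₂ seqₙ (nf-substitute eq M) (nf-substitute eq N))
          (sym (nf-substitute-seqₙ _ (nf M) (nf N)))

  nf-idempotent : (M : Term n) → nf (nf M) ≡ nf M
  nf-idempotent M = begin
    nf (nf M)                  ≡⟨ cong nf (substitute-var (nf M)) ⟨
    nf (substitute var (nf M)) ≡⟨ nf-substitute (λ _ → refl) M ⟨
    nf (substitute var M)      ≡⟨ cong nf (substitute-var M) ⟩
    nf M                       ∎

  pushₙ-⟶* : (N : Term n) → ∀ a M → [ N ] a ∙ M ⟶* pushₙ N a M
  pushₙ-⟶* N b (a ⟨⟩∙ M) with a ≟ b
  ... | yes _   = ε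
  ... | no  a≢b = passage a≢b ◅ gmap _ in-pop (pushₙ-⟶* (weaken N) b M)
  pushₙ-⟶* N b (var x)       = ε
  pushₙ-⟶* N b ([ P ] a ∙ M) = ε
  pushₙ-⟶* N b ⋆             = ε
  pushₙ-⟶* N b (M ⨾ P)       = ε

  seqₙ-⟶* : (M P : Term n) → M ⨾ P ⟶* seqₙ M P
  seqₙ-⟶* (var x)       P = ε
  seqₙ-⟶* (a ⟨⟩∙ M)     P = prefix-pop ◅ gmap _ in-pop (seqₙ-⟶* M (weaken P))
  seqₙ-⟶* ([ N ] a ∙ M) P = prefix-push ◅ gmap _ in-push (seqₙ-⟶* M P) ◅◅ pushₙ-⟶* N a _
  seqₙ-⟶* ⋆             P = next ◅ ε
  seqₙ-⟶* (M ⨾ Q)       P = associate ◅ gmap _ in-seqʳ (seqₙ-⟶* Q P) ◅◅ seqₙ-⟶* M _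

  nf-⟶* : (M : Term n) → M ⟶* nf M
  nf-⟶* (var x)       = ε
  nf-⟶* (a ⟨⟩∙ M)     = gmap _ in-pop (nf-⟶* M)
  nf-⟶* ([ N ] a ∙ M) =
    gmap ([_] a ∙ M) in-arg (nf-⟶* N) ◅◅ gmap _ in-push (nf-⟶* M) ◅◅ pushₙ-⟶* _ a _
  nf-⟶* ⋆             = ε
  nf-⟶* (M ⨾ N)       =
    gmap (_⨾ N) in-seqˡ (nf-⟶* M) ◅◅ gmap _ in-seqʳ (nf-⟶* N) ◅◅ seqₙ-⟶* (nf M) _

  pushₙ-⟶ˡ : ∀ a (M : Term n) → N ⟶ N′ → pushₙ N a M ⟶ pushₙ N′ a M
  pushₙ-⟶ˡ b (a ⟨⟩∙ M) r with a ≟ b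
  ... | yes _ = in-arg r
  ... | no  _ = in-pop (pushₙ-⟶ˡ b M (rename-⟶ suc r))
  pushₙ-⟶ˡ b (var x)       r = in-arg r
  pushₙ-⟶ˡ b ([ P ] a ∙ M) r = in-arg r
  pushₙ-⟶ˡ b ⋆             r = in-arg r
  pushₙ-⟶ˡ b (M ⨾ P)       r = in-arg r

  -- A step of `M` may bring a pop to its head, past which the push may then move; hence possibly
  -- more than one step.
  pushₙ-⟶ʳ : (N : Term n) → ∀ a → M ⟶ M′ → pushₙ N a M ⟶⁺ pushₙ N a M′
  pushₙ-⟶ʳ {M = a ⟨⟩∙ M} N b (in-pop r) with a ≟ b
  ... | yes _ = _ , in-push (in-pop r) , ε
  ... | no  _ = ⟶⁺-map (a ⟨⟩∙_) in-pop (pushₙ-⟶ʳ (weaken N) b r)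
  pushₙ-⟶ʳ {M = [ P ] a ∙ M} N b r = _ , in-push r , pushₙ-⟶* N b _
  pushₙ-⟶ʳ {M = M ⨾ P}       N b r = _ , in-push r , pushₙ-⟶* N b _

  seqₙ-⟶ʳ : (M : Term n) → P ⟶ P′ → seqₙ M P ⟶⁺ seqₙ M P′
  seqₙ-⟶ʳ (var x)       r = _ , in-seqʳ r , ε
  seqₙ-⟶ʳ (a ⟨⟩∙ M)     r = ⟶⁺-map (a ⟨⟩∙_) in-pop (seqₙ-⟶ʳ M (rename-⟶ suc r))
  seqₙ-⟶ʳ ([ N ] a ∙ M) r = ⟶⁺-bind (pushₙ N a) (pushₙ-⟶ʳ N a) (seqₙ-⟶ʳ M r)
  seqₙ-⟶ʳ ⋆             r = _ , r , ε
  seqₙ-⟶ʳ (M ⨾ Q)       r = ⟶⁺-bind (seqₙ M) (seqₙ-⟶ʳ M) (seqₙ-⟶ʳ Q r)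

  -- Chosen to decrease at every rule other than beta. A push counts its body twice, so lifting a
  -- pop out of it lowers the value. A sequence multiplies its left component by at least two, and
  -- the unit cost of whatever is lifted out escapes that factor; under `associate` the inner
  -- successor escapes it.
  weight : Term n → ℕ
  weight (var x)       = 1
  weight (a ⟨⟩∙ M)     = suc (weight M)
  weight ([ N ] a ∙ M) = suc (weight N + (weight M + weight M))
  weight ⋆             = 1
  weight (M ⨾ N)       = weight M * suc (weight N)

  weight-rename : (ρ : Fin m → Fin n) → ∀ M → weight (rename ρ M) ≡ weight M
  weight-rename ρ (var x)       = refl
  weight-rename ρ (a ⟨⟩∙ M)     = cong suc (weight-rename (lift 1 ρ) M)
  weight-rename ρ ([ N ] a ∙ M) =
    cong₂ (λ x y → suc (x + (y + y))) (weight-rename ρ N) (weight-rename ρ M)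
  weight-rename ρ ⋆             = refl
  weight-rename ρ (M ⨾ N)       =
    cong₂ (λ x y → x * suc y) (weight-rename ρ M) (weight-rename ρ N)

  0<weight : (M : Term n) → 0 < weight M
  0<weight (var x)       = z<s
  0<weight (a ⟨⟩∙ M)     = z<s
  0<weight ([ N ] a ∙ M) = z<s
  0<weight ⋆             = z<s
  0<weight (M ⨾ N)       = ℕ.*-mono-≤ (0<weight M) (z<s {weight N})

  private
    *-suc-< : ∀ n {m} → 0 < m → suc (n * suc m) < suc n * suc m
    *-suc-< n 0<m = s≤s (ℕ.+-monoˡ-≤ _ 0<m)

  weight-passage : (N : Term n) (M : Term (suc n)) →
    weight (a ⟨⟩∙ ([ weaken N ] b ∙ M)) < weight ([ N ] b ∙ (a ⟨⟩∙ M))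
  weight-passage N M
    rewrite weight-rename suc N | ℕ.+-suc (weight M) (weight M)
          | ℕ.+-suc (weight N) (suc (weight M + weight M))
          | ℕ.+-suc (weight N) (weight M + weight M) = ℕ.≤-refl

  weight-prefix-push : (P N M : Term n) →
    weight ([ P ] a ∙ (N ⨾ M)) < weight (([ P ] a ∙ N) ⨾ M)
  weight-prefix-push P N M
    rewrite ℕ.*-distribʳ-+ (suc (weight M)) (weight P) (weight N + weight N)
          | ℕ.*-distribʳ-+ (suc (weight M)) (weight N) (weight N)
    = s≤s (ℕ.+-mono-≤ (0<weight M) (ℕ.+-monoˡ-≤ _ (ℕ.m≤m*n (weight P) (suc (weight M)))))

  weight-seqʳ : (M : Term n) → weight N < weight P → weight (M ⨾ N) < weight (M ⨾ P)
  weight-seqʳ M lt = ℕ.*-monoʳ-< (weight M) ⦃ >-nonZero (0<weight M) ⦄ (s≤s lt)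

  -- `pushₙ` leaves a push in front of a pop at the same location, so the redex survives
  -- normalization and can be fired; `nf-substitute` identifies the normal form of the contractum.
  -- The body `R` is left general so that it may be `nf M` alone or already sequenced with a
  -- continuation.
  nf-beta : ∀ (N : Term n) a Q {R} → nf R ≡ nf Q →
            pushₙ (nf N) a (a ⟨⟩∙ R) ⟶⁺ nf (⟪ N ⟫ Q)
  nf-beta N a Q {R} eq rewrite pushₙ-≡ (nf N) a R =
    _ , beta , subst (⟪ nf N ⟫ R ⟶*_) nf≡ (nf-⟶* _)
    where
    nfσ : ∀ x → nf ((N Vector.∷ var) x) ≡ nf ((nf N Vector.∷ var) x)
    nfσ zero    = sym (nf-idempotent N)
    nfσ (suc x) = refl

    nf≡ : nf (⟪ nf N ⟫ R) ≡ nf (⟪ N ⟫ Q)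
    nf≡ = begin
      nf (⟪ nf N ⟫ R)        ≡⟨ nf-substitute (λ _ → refl) R ⟩
      nf (⟪ nf N ⟫ (nf R))   ≡⟨ cong (λ X → nf (⟪ nf N ⟫ X)) eq ⟩
      nf (⟪ nf N ⟫ (nf Q))   ≡⟨ nf-substitute nfσ Q ⟨
      nf (⟪ N ⟫ Q)           ∎

  nf-passage : ∀ (N : Term n) M → a ≢ b →
               nf ([ N ] b ∙ (a ⟨⟩∙ M)) ≡ nf (a ⟨⟩∙ ([ weaken N ] b ∙ M))
  nf-passage {a = a} {b} N M a≢b = trans (pushₙ-≢ a≢b (nf N) (nf M))
    (cong (λ X → a ⟨⟩∙ pushₙ X b (nf M)) (sym (nf-rename suc N)))

  nf-prefix-pop : ∀ N (M : Term n) → nf ((a ⟨⟩∙ N) ⨾ M) ≡ nf (a ⟨⟩∙ (N ⨾ weaken M))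
  nf-prefix-pop {a = a} N M = cong (λ X → a ⟨⟩∙ seqₙ (nf N) X) (sym (nf-rename suc M))

  -- The continuation P is needed because seqₙ distributes it into M, so that a
  -- redex of M reappears around P.
  Simulated : Term n → Term n → Set
  Simulated M M′ =
    (nf M ≡ nf M′ × weight M′ < weight M) ⊎
    (nf M ⟶⁺ nf M′ × ∀ P → nf (M ⨾ P) ⟶⁺ nf (M′ ⨾ P))

  simulation : M ⟶ M′ → Simulated M M′
  simulation (beta {N} {a} {M}) = inj₂ (nf-beta N a M (nf-idempotent M) , λ P →
    subst₂ _⟶⁺_ (sym (seqₙ-push (nf N) a (a ⟨⟩∙ nf M) (nf P)))
                (cong (λ X → nf (⟪ N ⟫ M ⨾ X)) (⟪⟫-weaken N P))
                (nf-beta N a (M ⨾ weaken P) (begin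
      nf (seqₙ (nf M) (weaken (nf P)))   ≡⟨ cong (nf ∘ seqₙ (nf M)) (nf-rename suc P) ⟨
      nf (nf (M ⨾ weaken P))             ≡⟨ nf-idempotent (M ⨾ weaken P) ⟩
      nf (M ⨾ weaken P)                  ∎)))
  simulation (passage {N} {a} {b} {M} a≢b) =
    inj₁ (nf-passage N M a≢b , weight-passage {a = a} {b} N M)
  simulation (next {M}) = inj₁ (refl , ℕ.≤-reflexive (sym (ℕ.*-identityˡ (suc (weight M)))))
  simulation (prefix-pop {a} {N} {M}) = inj₁ (nf-prefix-pop N M
    , subst (λ m → suc (weight N * suc m) < suc (weight N) * suc (weight M))
        (sym (weight-rename suc M)) (*-suc-< (weight N) (0<weight M)))
  simulation (prefix-push {P} {a} {N} {M}) = inj₁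
    (seqₙ-push (nf P) a (nf N) (nf M) , weight-prefix-push {a = a} P N M)
  simulation (associate {P} {N} {M}) = inj₁
    ( seqₙ-assoc (nf P) (nf N) (nf M)
    , subst (weight (P ⨾ (N ⨾ M)) <_)
        (sym (ℕ.*-assoc (weight P) (suc (weight N)) (suc (weight M))))
        (ℕ.*-monoʳ-< (weight P) ⦃ >-nonZero (0<weight P) ⦄
          (*-suc-< (weight N) (0<weight M))))
  simulation (in-pop {a} {M} {M′} r) with simulation r
  ... | inj₁ (eq , lt) = inj₁ (cong (a ⟨⟩∙_) eq , s≤s lt)
  ... | inj₂ (rs , ss) = inj₂
    ( ⟶⁺-map (a ⟨⟩∙_) in-pop rs
    , λ P → ⟶⁺-map (a ⟨⟩∙_) in-pop
              (subst (λ X → seqₙ (nf M) X ⟶⁺ seqₙ (nf M′) X) (nf-rename suc P) (ss (weaken P))))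
  simulation (in-arg {N} {N′} {a} {M} r) with simulation r
  ... | inj₁ (eq , lt) = inj₁ (cong (λ X → pushₙ X a (nf M)) eq , s≤s (ℕ.+-monoˡ-< _ lt))
  ... | inj₂ (rs , ss) = inj₂
    ( ⟶⁺-map (λ X → pushₙ X a (nf M)) (pushₙ-⟶ˡ a (nf M)) rs
    , λ P → subst₂ _⟶⁺_ (sym (seqₙ-push (nf N) a (nf M) (nf P)))
                        (sym (seqₙ-push (nf N′) a (nf M) (nf P)))
              (⟶⁺-map (λ X → pushₙ X a (seqₙ (nf M) (nf P))) (pushₙ-⟶ˡ a (seqₙ (nf M) (nf P))) rs))
  simulation (in-push {N} {a} {M} {M′} r) with simulation r
  ... | inj₁ (eq , lt) = inj₁
    (cong (pushₙ (nf N) a) eq , s≤s (ℕ.+-monoʳ-< (weight N) (ℕ.+-mono-< lt lt)))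
  ... | inj₂ (rs , ss) = inj₂
    ( ⟶⁺-bind (pushₙ (nf N) a) (pushₙ-⟶ʳ (nf N) a) rs
    , λ P → subst₂ _⟶⁺_ (sym (seqₙ-push (nf N) a (nf M) (nf P)))
                        (sym (seqₙ-push (nf N) a (nf M′) (nf P)))
              (⟶⁺-bind (pushₙ (nf N) a) (pushₙ-⟶ʳ (nf N) a) (ss P)))
  simulation (in-seqˡ {N} {N′} {M} r) with simulation r
  ... | inj₁ (eq , lt) = inj₁ (cong (λ X → seqₙ X (nf M)) eq , ℕ.*-monoˡ-< (suc (weight M)) lt)
  ... | inj₂ (rs , ss) = inj₂
    -- Here the continuation clause of the hypothesis pays off: `M`, and then `M ⨾ P`, is the
    -- continuation of `N`.
    ( ss M
    , λ P → subst₂ _⟶⁺_ (sym (seqₙ-assoc (nf N) (nf M) (nf P)))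
                        (sym (seqₙ-assoc (nf N′) (nf M) (nf P))) (ss (M ⨾ P)))
  simulation (in-seqʳ {N} {M} {M′} r) with simulation r
  ... | inj₁ (eq , lt) = inj₁ (cong (seqₙ (nf N)) eq , weight-seqʳ {N = M′} {P = M} N lt)
  ... | inj₂ (rs , ss) = inj₂
    ( ⟶⁺-bind (seqₙ (nf N)) (seqₙ-⟶ʳ (nf N)) rs
    , λ P → subst₂ _⟶⁺_ (sym (seqₙ-assoc (nf N) (nf M) (nf P)))
                        (sym (seqₙ-assoc (nf N) (nf M′) (nf P)))
              (⟶⁺-bind (seqₙ (nf N)) (seqₙ-⟶ʳ (nf N)) (ss P)))

  SN-⟶* : StronglyNormalizing M → M ⟶* N → StronglyNormalizing N
  SN-⟶* sn       ε        = sn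
  SN-⟶* (acc sn) (r ◅ rs) = SN-⟶* (sn r) rs

  SN-reflect : (f : Term m → Term n) → (∀ {M N} → M ⟶ N → f M ⟶ f N) →
               StronglyNormalizing (f M) → StronglyNormalizing M
  SN-reflect f F (acc sn) = acc λ r → SN-reflect f F (sn (F r))

  -- Lexicographic induction on the strong normalization of `N`, then on the weight of `M`. A step
  -- preserving `nf M` lowers the weight; one that reduces `nf M` lets `N` advance by at least one
  -- step, and the weight starts afresh.
  SN-from-nf : StronglyNormalizing N → N ⟶* nf M → Acc _<_ (weight M) → StronglyNormalizing M
  SN-from-nf {N = N} (acc sn) rs (acc smaller) = acc λ r →
    [ (λ (eq , lt) → SN-from-nf (acc sn) (subst (N ⟶*_) eq rs) (smaller lt))
    , (λ (ss , _) → let _ , s , ss′ = *⁺-trans rs ss in SN-from-nf (sn s) ss′ (<-wellFounded _))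
    ]′ (simulation r)

  SN-nf≡ : nf M ≡ nf N → StronglyNormalizing N → StronglyNormalizing M
  SN-nf≡ {N = N} eq sn = SN-from-nf sn (subst (N ⟶*_) (sym eq) (nf-⟶* N)) (<-wellFounded _)

-- Reducibility by orthogonality of stacks and continuations.

module Reducibility (A : Locations) where
  open FMC A
  open Rewriting A

  private variable
    m n             : ℕ
    a b             : Location
    M M′ N          : Term n
    R               : Pushes n
    τ τ′            : Computation
    ι ι′            : Collection
    κ κ′            : VectorType

  -- Unlike in H ▷ M, the first element of the list is the innermost application.
  plug : Pushes n → Term n → Term n
  plug []            M = M
  plug ((N , a) ∷ R) M = plug R ([ N ] a ∙ M)

  plug-⟶ : (R : Pushes n) → M ⟶ M′ → plug R M ⟶ plug R M′
  plug-⟶ []            r = r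
  plug-⟶ ((N , a) ∷ R) r = plug-⟶ R (in-push r)

  nf-plug : (R : Pushes n) → nf M ≡ nf N → nf (plug R M) ≡ nf (plug R N)
  nf-plug []            eq = eq
  nf-plug ((N , a) ∷ R) eq = nf-plug R (cong (pushₙ (nf N) a) eq)

  SN-plug : (R : Pushes n) → nf M ≡ nf N →
            StronglyNormalizing (plug R N) → StronglyNormalizing (plug R M)
  SN-plug R eq = SN-nf≡ (nf-plug R eq)

  NotPop : Term n → Set
  NotPop M = ∀ {a M′} → M ≢ a ⟨⟩∙ M′

  -- A term that is not a pop cannot interact with the push in front of it. A step in the pushes is
  -- returned uniformly in the plugged term, so that it can be replayed around another one.
  plug-⟶⁻¹ : ∀ (R : Pushes n) {M P} → NotPop M → plug R M ⟶ P →
    (∃ λ M′ → M ⟶ M′ × P ≡ plug R M′) ⊎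
    (∃ λ R′ → (∀ {X} → plug R X ⟶ plug R′ X) × P ≡ plug R′ M)
  plug-⟶⁻¹ []            np r = inj₁ (_ , r , refl)
  plug-⟶⁻¹ ((N , a) ∷ R) np r with plug-⟶⁻¹ R (λ ()) r
  ... | inj₁ (_ , beta , eq)      = contradiction refl np
  ... | inj₁ (_ , passage _ , eq) = contradiction refl np
  ... | inj₁ (_ , in-arg s , eq)  = inj₂ (_ ∷ R , plug-⟶ R (in-arg s) , eq)
  ... | inj₁ (_ , in-push s , eq) = inj₁ (_ , s , eq)
  ... | inj₂ (R′ , s , eq)        = inj₂ (_ ∷ R′ , s , eq)

  -- Nested induction on the strong normalization of `N` and of the contractum. Steps in the body or
  -- in the pushes are mirrored by one step of the contractum.
  beta-expansion : ∀ (R : Pushes n) {N M} → StronglyNormalizing N →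
    StronglyNormalizing (plug R (⟪ N ⟫ M)) →
    StronglyNormalizing (plug R ([ N ] a ∙ (a ⟨⟩∙ M)))
  beta-expansion {a = a} R {N} {M} (acc snN) = go R M
    where
    go : ∀ R M → StronglyNormalizing (plug R (⟪ N ⟫ M)) →
         StronglyNormalizing (plug R ([ N ] a ∙ (a ⟨⟩∙ M)))
    step : ∀ R M {X} → (∀ {P} → plug R (⟪ N ⟫ M) ⟶ P → StronglyNormalizing P) →
           plug R ([ N ] a ∙ (a ⟨⟩∙ M)) ⟶ X → StronglyNormalizing X
    go R M (acc sn) = acc (step R M sn)
    step R M sn r with plug-⟶⁻¹ R (λ ()) r
    ... | inj₁ (_ , beta , refl)             = acc sn
    ... | inj₁ (_ , passage a≢a , refl)      = contradiction refl a≢a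
    -- The contractum holds any number of copies of `N`, possibly none, so it need not decrease; the
    -- hypothesis on `N` does.
    ... | inj₁ (_ , in-arg s , refl)         = beta-expansion R (snN s)
      (SN-⟶* (acc sn) (gmap (plug R) (plug-⟶ R)
        (substitute-⟶* (λ { zero → s ◅ ε ; (suc x) → ε }) M)))
    ... | inj₁ (_ , in-push (in-pop s) , refl) = go R _ (sn (plug-⟶ R (substitute-⟶ _ s)))
    ... | inj₂ (R′ , s , refl)               = go R′ M (sn s)

  SN-pop : StronglyNormalizing M → StronglyNormalizing (a ⟨⟩∙ M)
  SN-pop (acc sn) = acc λ { (in-pop r) → SN-pop (sn r) }

  -- Such terms never become a pop, so pushes in front of them form no redex with them. Being
  -- inductive, the predicate also contains strong normalization.
  data Inert {n} (M : Term n) : Set where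
    inert : NotPop M → (∀ {M′} → M ⟶ M′ → Inert M′) → Inert M

  inert⇒SN : Inert M → StronglyNormalizing M
  inert⇒SN (inert _ f) = acc λ r → inert⇒SN (f r)

  inert-unit : Inert {n} ⋆
  inert-unit = inert (λ ()) λ ()

  inert-seq : ∀ {x} → StronglyNormalizing M → Inert (var x ⨾ M)
  inert-seq (acc sn) = inert (λ ()) λ { (in-seqʳ r) → inert-seq (sn r) }

  inert-push : StronglyNormalizing N → Inert M → Inert ([ N ] a ∙ M)
  inert-push {N = N} {a = a} (acc snN) = go
    where
    go : ∀ {M} → Inert M → Inert ([ N ] a ∙ M)
    go (inert np f) = inert (λ ()) λ
      { beta        → contradiction refl np
      ; (passage _) → contradiction refl np
      ; (in-arg r)  → inert-push (snN r) (inert np f)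
      ; (in-push r) → go (f r) }

  -- Demanded of stacks apart from their types, which say nothing about an argument at the empty
  -- collection or below the entries that the type lists.
  AllSN : Pushes n → Set
  AllSN = All (StronglyNormalizing ∘ proj₁)

  inert-plug : AllSN R → Inert M → Inert (plug R M)
  inert-plug []         i = i
  inert-plug (sn ∷ sns) i = inert-plug sns (inert-push sn i)

  project : Location → Pushes n → List (Term n)
  project b []            = []
  project b ((N , a) ∷ R) = if does (a ≟ b) then N ∷ project b R else project b R

  if-≡ : ∀ {X : Set} a {x y : X} → (if does (a ≟ a) then x else y) ≡ x
  if-≡ a {x} {y} = cong (λ t → if t then x else y) (dec-true (a ≟ a) refl)

  if-≢ : ∀ {X : Set} → a ≢ b → {x y : X} → (if does (a ≟ b) then x else y) ≡ y
  if-≢ {a} {b} a≢b {x} {y} = cong (λ t → if t then x else y) (dec-false (a ≟ b) a≢b)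

  -- Orthogonality: a term of type I ⇒ K, sequenced with any continuation that is
  -- safe for every stack of type K, is safe for every stack of type I.  A stack
  -- may be shorter or longer than its type: only the common part, counted from the
  -- top, has to agree.
  ⟦_⟧  : Computation → Term n → Set
  ⟦_⟧ᶜ : Collection → Term n → Set
  ⟦_⟧ᵛ : VectorType → List (Term n) → Set

  ⟦ I ⇒ K ⟧ M = ∀ R → AllSN R → (∀ a → ⟦ I a ⟧ᵛ (project a R)) →
    ∀ P → (∀ T → AllSN T → (∀ a → ⟦ K a ⟧ᵛ (project a T)) → StronglyNormalizing (plug T P)) →
    StronglyNormalizing (plug R (M ⨾ P))

  ⟦ [] ⟧ᶜ    M = ⊤
  ⟦ τ ∷ ι ⟧ᶜ M = ⟦ τ ⟧ M × ⟦ ι ⟧ᶜ M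

  ⟦ ι ∷ κ ⟧ᵛ (N ∷ Ns) = ⟦ ι ⟧ᶜ N × ⟦ κ ⟧ᵛ Ns
  ⟦ _     ⟧ᵛ _        = ⊤

  Fits : Memory → Pushes n → Set
  Fits I R = ∀ a → ⟦ I a ⟧ᵛ (project a R)

  -- An equivalence because input memories are contravariant: either direction at an arrow uses both
  -- directions below it.
  ⟦⟧-≈     : τ ≈ τ′ → ⟦ τ ⟧ M ⇔ ⟦ τ′ ⟧ M
  ⟦⟧ᶜ-≈    : ι ≈ᶜ ι′ → ⟦ ι ⟧ᶜ M ⇔ ⟦ ι′ ⟧ᶜ M
  ⟦⟧ᶜ-≈ᵖ   : Pointwise _≈_ ι ι′ → ⟦ ι ⟧ᶜ M ⇔ ⟦ ι′ ⟧ᶜ M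
  ⟦⟧ᵛ-≈    : ∀ {Ns : List (Term n)} → Pointwise _≈ᶜ_ κ κ′ → ⟦ κ ⟧ᵛ Ns ⇔ ⟦ κ′ ⟧ᵛ Ns

  ⟦⟧-≈ {M = M} (I≈ ⇒ K≈) = mk⇔
    (λ h R snR fits P P⊥ → h R snR (λ a → from (⟦⟧ᵛ-≈ (I≈ a)) (fits a)) P
      (λ T snT fitsT → P⊥ T snT (λ a → to (⟦⟧ᵛ-≈ (K≈ a)) (fitsT a))))
    (λ h R snR fits P P⊥ → h R snR (λ a → to (⟦⟧ᵛ-≈ (I≈ a)) (fits a)) P
      (λ T snT fitsT → P⊥ T snT (λ a → from (⟦⟧ᵛ-≈ (K≈ a)) (fitsT a))))
    where open Equivalence

  ⟦⟧ᶜ-≈ (Permutation.refl ps)    = ⟦⟧ᶜ-≈ᵖ ps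
  ⟦⟧ᶜ-≈ (Permutation.prep p ps)  = ⟦⟧-≈ p ×-⇔ ⟦⟧ᶜ-≈ ps
  ⟦⟧ᶜ-≈ (Permutation.swap p q ps) = mk⇔
    (λ (x , y , zs) → to (⟦⟧-≈ q) y , to (⟦⟧-≈ p) x , to (⟦⟧ᶜ-≈ ps) zs)
    (λ (y , x , zs) → from (⟦⟧-≈ p) x , from (⟦⟧-≈ q) y , from (⟦⟧ᶜ-≈ ps) zs)
    where open Equivalence
  ⟦⟧ᶜ-≈ (Permutation.trans ps qs) = ⟦⟧ᶜ-≈ qs ⇔-∘ ⟦⟧ᶜ-≈ ps

  ⟦⟧ᶜ-≈ᵖ []       = ⇔-id _
  ⟦⟧ᶜ-≈ᵖ (p ∷ ps) = ⟦⟧-≈ p ×-⇔ ⟦⟧ᶜ-≈ᵖ ps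

  ⟦⟧ᵛ-≈               []       = ⇔-id _
  ⟦⟧ᵛ-≈ {Ns = []}     (p ∷ ps) = ⇔-id _
  ⟦⟧ᵛ-≈ {Ns = N ∷ Ns} (p ∷ ps) = ⟦⟧ᶜ-≈ p ×-⇔ ⟦⟧ᵛ-≈ ps

  ⟦⟧ᶜ-++ : ∀ ι → ⟦ ι ++ ι′ ⟧ᶜ M → ⟦ ι ⟧ᶜ M × ⟦ ι′ ⟧ᶜ M
  ⟦⟧ᶜ-++ []      h       = _ , h
  ⟦⟧ᶜ-++ (τ ∷ ι) (h , hs) = let h₁ , h₂ = ⟦⟧ᶜ-++ ι hs in (h , h₁) , h₂

  ⟦⟧ᵛ-[] : ∀ κ → ⟦ κ ⟧ᵛ ([] {A = Term n})
  ⟦⟧ᵛ-[] []      = _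
  ⟦⟧ᵛ-[] (_ ∷ _) = _

  -- The empty stack fits every type, and `⋆` is safe for every stack of strongly normalizing terms,
  -- so `M ⨾ ⋆` is strongly normalizing.
  ⟦⟧-SN : ∀ τ → ⟦ τ ⟧ M → StronglyNormalizing M
  ⟦⟧-SN (I ⇒ K) h = SN-reflect (_⨾ ⋆) in-seqˡ
    (h [] [] (λ a → ⟦⟧ᵛ-[] (I a)) ⋆ (λ T snT _ → inert⇒SN (inert-plug snT inert-unit)))

  ⟦⟧-var : ∀ τ (x : Fin n) → ⟦ τ ⟧ (var x)
  ⟦⟧-var (I ⇒ K) x R snR _ P P⊥ =
    inert⇒SN (inert-plug snR (inert-seq (P⊥ [] [] (λ a → ⟦⟧ᵛ-[] (K a)))))

  ⟦⟧ᶜ-var : ∀ ι (x : Fin n) → ⟦ ι ⟧ᶜ (var x)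
  ⟦⟧ᶜ-var []      x = _
  ⟦⟧ᶜ-var (τ ∷ ι) x = ⟦⟧-var τ x , ⟦⟧ᶜ-var ι x

  -- The pop moves in front of all the pushes, none being at its location, and each push passed
  -- joins its body. Any `N` can then witness that the body is strongly normalizing, since
  -- substitution preserves steps.
  pop-missing : ∀ (R : Pushes n) {N M} → project a R ≡ [] →
    StronglyNormalizing (plug R (⟪ N ⟫ M)) → StronglyNormalizing (plug R (a ⟨⟩∙ M))
  pop-missing []                        eq sn = SN-pop (SN-reflect ⟪ _ ⟫_ (substitute-⟶ _) sn)
  pop-missing {a = a} ((P , b) ∷ R) {N} {M} eq sn with b ≟ a
  ... | yes refl = contradiction (trans (sym eq) (if-≡ b)) λ ()
  ... | no b≢a   = SN-plug R (nf-passage P M (b≢a ∘ sym))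
    (pop-missing R {M = [ weaken P ] b ∙ M} (trans (sym (if-≢ b≢a)) eq)
      (subst (λ X → StronglyNormalizing (plug R ([ X ] b ∙ ⟪ N ⟫ M))) (sym (⟪⟫-weaken N P)) sn))

  -- What remains of the stack once its topmost entry at `a` is taken. The field `expansion`
  -- combines the passages that bring the pop next to that entry with the beta step that consumes
  -- it.
  record Popped (a : Location) (R : Pushes n) (N : Term n) (Ns : List (Term n)) : Set where
    field
      rest      : Pushes n
      project-≡ : project a rest ≡ Ns
      project-≢ : ∀ {b} → a ≢ b → project b rest ≡ project b R
      restSN    : AllSN rest
      expansion : ∀ {M} → StronglyNormalizing (plug rest (⟪ N ⟫ M)) →
                  StronglyNormalizing (plug R (a ⟨⟩∙ M))

  pop-present : ∀ {R : Pushes n} {N Ns} → AllSN R → project a R ≡ N ∷ Ns → Popped a R N Ns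
  pop-present {a = a} {(P , b) ∷ R} {N} (snP ∷ snR) eq with b ≟ a
  ... | yes refl with refl ← trans (sym (if-≡ b)) eq = record
    { rest      = R
    ; project-≡ = refl
    ; project-≢ = λ a≢c → sym (if-≢ a≢c)
    ; restSN    = snR
    ; expansion = beta-expansion R snP
    }
  ... | no b≢a = record
    { rest      = (P , b) ∷ rest
    ; project-≡ = trans (if-≢ b≢a) project-≡
    ; project-≢ = λ {c} a≢c → cong (λ Ns → if does (b ≟ c) then P ∷ Ns else Ns) (project-≢ a≢c)
    ; restSN    = snP ∷ restSN
    ; expansion = λ {M} sn → SN-plug R (nf-passage P M (b≢a ∘ sym)) (expansion {[ weaken P ] b ∙ M}
        (subst (λ X → StronglyNormalizing (plug rest ([ X ] b ∙ ⟪ N ⟫ M))) (sym (⟪⟫-weaken N P)) sn))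
    }
    where open Popped (pop-present snR (trans (sym (if-≢ b≢a)) eq))

  Realizes : Context m → (Fin m → Term n) → Set
  Realizes Γ σ = ∀ x → ⟦ Γ x ⟧ᶜ (σ x)

  realizes-⊕ : ∀ {Γ Δ : Context m} {σ : Fin m → Term n} →
               Realizes (Γ ⊕ Δ) σ → Realizes Γ σ × Realizes Δ σ
  realizes-⊕ {Γ = Γ} h = (λ x → proj₁ (⟦⟧ᶜ-++ (Γ x) (h x))) , (λ x → proj₂ (⟦⟧ᶜ-++ (Γ x) (h x)))

  -- The variable v stands in for arguments missing from a stack.
  sound  : ∀ {Γ : Context m} {σ : Fin m → Term n} → Fin n →
           Γ ⊢ₛ M ∶ τ → Realizes Γ σ → ⟦ τ ⟧ (substitute σ M)
  soundᶜ : ∀ {Γ : Context m} {σ : Fin m → Term n} → Fin n →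
           Γ ⊢ₛᶜ M ∶ ι → Realizes Γ σ → ⟦ ι ⟧ᶜ (substitute σ M)

  sound v (variable′ {x}) env with x Fin.≟ x | env x
  ... | yes _   | h , _ = h
  ... | no  x≢x | _     = contradiction refl x≢x
  sound {σ = σ} v (abstraction {Γ} {ι} {a} {M} {K} {L} d) env R snR fits P P⊥ =
    -- With `P` moved under the binder, the pop faces the stack directly.
    SN-plug R (nf-prefix-pop (substitute (liftₛ σ) M) P) popped
    where
    ext : ∀ {N} → ⟦ ι ⟧ᶜ N → Realizes (Γ ▹ ι) (N Vector.∷ σ)
    ext h zero    = h
    ext h (suc x) = env x

    body : ∀ {N R} → ⟦ ι ⟧ᶜ N → AllSN R → Fits K R →
           StronglyNormalizing (plug R (⟪ N ⟫ (substitute (liftₛ σ) M ⨾ weaken P)))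
    body {N} {R} h snR fits =
      subst₂ (λ X Y → StronglyNormalizing (plug R (X ⨾ Y)))
        (sym (⟪⟫-liftₛ N σ M)) (sym (⟪⟫-weaken N P))
        (sound v d (ext h) _ snR fits P P⊥)

    fits-at : ⟦ ι ∷ K a ⟧ᵛ (project a R)
    fits-at = subst (λ κ → ⟦ κ ⟧ᵛ (project a R)) (if-≡ a) (fits a)

    fits-off : ∀ {b} → a ≢ b → ⟦ K b ⟧ᵛ (project b R)
    fits-off {b} a≢b = subst (λ κ → ⟦ κ ⟧ᵛ (project b R)) (if-≢ a≢b) (fits b)

    popped : StronglyNormalizing (plug R (a ⟨⟩∙ (substitute (liftₛ σ) M ⨾ weaken P)))
    popped with project a R in eq | fits-at
    -- With no entry at `a`, the body is instantiated with `v`, as a variable realizes every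
    -- collection.
    ... | [] | _ = pop-missing R eq (body (⟦⟧ᶜ-var ι v) snR fits′)
      where
      fits′ : Fits K R
      fits′ b with a ≟ b
      ... | yes refl = subst ⟦ K a ⟧ᵛ (sym eq) (⟦⟧ᵛ-[] (K a))
      ... | no  a≢b  = fits-off a≢b
    ... | N ∷ Ns | h , hs = expansion (body h restSN fits′)
      where
      open Popped (pop-present snR eq)
      fits′ : Fits K rest
      fits′ b with a ≟ b
      ... | yes refl = subst ⟦ K a ⟧ᵛ (sym project-≡) hs
      ... | no  a≢b  = subst ⟦ K b ⟧ᵛ (sym (project-≢ a≢b)) (fits-off a≢b)
  sound {σ = σ} v (strong-application {N = N} {ι} {a} {M} {K} {τ = τ} dN dM dN′)
        env R snR fits P P⊥ =
    -- The argument joins the stack. Its collection may be empty, so its strong normalization is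
    -- drawn from the extra premise `dN′`.
    SN-plug R (seqₙ-push (nf (substitute σ N)) a (nf (substitute σ M)) (nf P))
      (sound v dM (proj₂ env₁) _ (⟦⟧-SN τ (sound v dN′ (proj₂ env₂)) ∷ snR) fits′ P P⊥)
    where
    env₂ = realizes-⊕ env
    env₁ = realizes-⊕ (proj₁ env₂)
    fits′ : Fits (K · ι at a) ((substitute σ N , a) ∷ R)
    fits′ b with a ≟ b
    ... | yes refl = subst₂ ⟦_⟧ᵛ (sym (if-≡ a)) (sym (if-≡ a)) (soundᶜ v dN (proj₁ env₁) , fits a)
    ... | no  a≢b  = subst₂ ⟦_⟧ᵛ (sym (if-≢ a≢b)) (sym (if-≢ a≢b)) (fits b)
  sound v unit env R snR fits P P⊥ = SN-plug R refl (P⊥ R snR fits)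
  sound {σ = σ} v (sequencing {N = N} {M} dN dM) env R snR fits P P⊥ =
    -- The continuation of `N` becomes `M` followed by `P`, whose safety is the induction hypothesis
    -- for `M`.
    SN-plug R (seqₙ-assoc (nf (substitute σ N)) (nf (substitute σ M)) (nf P))
      (sound v dN (proj₁ env′) R snR fits _
        (λ T snT fitsT → sound v dM (proj₂ env′) T snT fitsT P P⊥))
    where env′ = realizes-⊕ env
  sound v (weakening d) env = sound v d (proj₁ (realizes-⊕ env))
  sound v (conv Γ≈ τ≈ d) env =
    Equivalence.to (⟦⟧-≈ τ≈) (sound v d (λ x → Equivalence.from (⟦⟧ᶜ-≈ (Γ≈ x)) (env x)))

  soundᶜ v []       env = _
  soundᶜ v (d ∷ ds) env = let env′ = realizes-⊕ env in
    sound v d (proj₁ env′) , soundᶜ v ds (proj₂ env′)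
  soundᶜ v (conv Γ≈ ι≈ d) env =
    Equivalence.to (⟦⟧ᶜ-≈ ι≈) (soundᶜ v d (λ x → Equivalence.from (⟦⟧ᶜ-≈ (Γ≈ x)) (env x)))

  -- All variables are shifted by one, so that `zero` is available as the stand-in even when `n` is
  -- 0.
  typeable⇒SN : StronglyTypeable M → StronglyNormalizing M
  typeable⇒SN {n} (Γ , τ , d) = SN-reflect (substitute σ) (substitute-⟶ σ)
    (⟦⟧-SN τ (sound zero d (λ x → ⟦⟧ᶜ-var (Γ x) (suc x))))
    where
    σ : Fin n → Term (suc n)
    σ x = var (suc x)

-- Perpetual evaluation of strongly normalizing terms.

module Evaluation (A : Locations) where
  open FMC A

  private variable
    m n             : ℕ
    a b             : Location
    M M′ N P 𝓜      : Term n
    H 𝓗             : Pushes n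

  infix 4 _◁_

  -- The positions into which evaluation descends; `push` serves to walk along the applications of a
  -- spine.
  data _◁_ : Term m → Term n → Set where
    body : M ◁ a ⟨⟩∙ M
    arg  : N ◁ [ N ] a ∙ M
    push : M ◁ [ N ] a ∙ M
    rest : M ◁ N ⨾ M

  data HereditarilySN : Term n → Set where
    hsn : (∀ {M′} → M ⟶ M′ → HereditarilySN M′) →
          (∀ {m} {N : Term m} → N ◁ M → HereditarilySN N) → HereditarilySN M

  hsn-child : HereditarilySN M → N ◁ M → HereditarilySN N
  hsn-child (hsn _ sub) = sub

  -- A reduction of a subterm is a reduction of the whole term, so the subterms
  -- inherit the hypothesis by structural recursion.
  hsn-intro : ∀ (M : Term n) → (∀ {M′} → M ⟶ M′ → HereditarilySN M′) → HereditarilySN M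
  hsn-intro (var x)       ih = hsn ih λ ()
  hsn-intro (a ⟨⟩∙ M)     ih = hsn ih λ
    { body → hsn-intro M (λ r → hsn-child (ih (in-pop r)) body) }
  hsn-intro ([ N ] a ∙ M) ih = hsn ih λ
    { arg  → hsn-intro N (λ r → hsn-child (ih (in-arg r)) arg)
    ; push → hsn-intro M (λ r → hsn-child (ih (in-push r)) push) }
  hsn-intro ⋆             ih = hsn ih λ ()
  hsn-intro (N ⨾ M)       ih = hsn ih λ
    { rest → hsn-intro M (λ r → hsn-child (ih (in-seqʳ r)) rest) }

  SN⇒hsn : StronglyNormalizing M → HereditarilySN M
  SN⇒hsn {M = M} (acc sn) = hsn-intro M (λ r → SN⇒hsn (sn r))

  -- The cases follow the evaluation rules. `at-redex` gathers those whose only premise evaluates a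
  -- reduct; beta stands apart for its second premise. `at-pop` has no pushes, since a push facing a
  -- pop is a redex.
  data Spine {n} : Term n → Set where
    at-pop   : ∀ {a M} → Spine (a ⟨⟩∙ M)
    at-beta  : ∀ H {N a M} → Spine (H ▷ [ N ] a ∙ (a ⟨⟩∙ M))
    at-redex : ∀ H {M M′} → M ⟶ M′ → (∀ H {𝓜} → (H ▷ M′) ▶ 𝓜 → (H ▷ M) ▶ 𝓜) → Spine (H ▷ M)
    at-unit  : ∀ H → Spine (H ▷ ⋆)
    at-var   : ∀ H {x} → Spine (H ▷ var x)
    at-seq   : ∀ H {x M} → Spine (H ▷ var x ⨾ M)

  spine : (M : Term n) → Spine M
  spine (var x)               = at-var []
  spine (a ⟨⟩∙ M)             = at-pop
  spine ([ N ] a ∙ M) with spine M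
  ... | at-pop {b} with b ≟ a
  ...   | yes refl            = at-beta []
  ...   | no b≢a              = at-redex [] (passage b≢a) (λ H → passage {H = H} b≢a)
  spine ([ N ] a ∙ M) | at-beta H      = at-beta ((N , a) ∷ H)
  spine ([ N ] a ∙ M) | at-redex H r e = at-redex ((N , a) ∷ H) r e
  spine ([ N ] a ∙ M) | at-unit H      = at-unit ((N , a) ∷ H)
  spine ([ N ] a ∙ M) | at-var H       = at-var ((N , a) ∷ H)
  spine ([ N ] a ∙ M) | at-seq H       = at-seq ((N , a) ∷ H)
  spine ⋆                     = at-unit []
  spine (var x ⨾ M)           = at-seq []
  spine (a ⟨⟩∙ N ⨾ M)         = at-redex [] prefix-pop (λ H → prefix-pop {H = H})
  spine (([ P ] a ∙ N) ⨾ M)   = at-redex [] prefix-push (λ H → prefix-push {H = H})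
  spine (⋆ ⨾ M)               = at-redex [] next (λ H → next {H = H})
  spine ((P ⨾ N) ⨾ M)         = at-redex [] associate (λ H → associate {H = H})

  ▷-⟶ : ∀ (H : Pushes n) → M ⟶ M′ → (H ▷ M) ⟶ (H ▷ M′)
  ▷-⟶ []      r = r
  ▷-⟶ (_ ∷ H) r = in-push (▷-⟶ H r)

  neutral-▷ : All (Normal ∘ proj₁) 𝓗 → Neutral M → Neutral (𝓗 ▷ M)
  neutral-▷ []       ne = ne
  neutral-▷ (n ∷ ns) ne = push n (neutral-▷ ns ne)

  evaluate       : HereditarilySN M → PerpetuallyEvaluates M
  evaluate-reduct : HereditarilySN M → M ⟶ M′ → PerpetuallyEvaluates M′
  evaluate-pushes : ∀ H → HereditarilySN (H ▷ M) →
                    ∃ λ 𝓗 → All (Normal ∘ proj₁) 𝓗 × H ▶* 𝓗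
  evaluate-arg   : ∀ H → HereditarilySN (H ▷ [ N ] a ∙ M) → PerpetuallyEvaluates N
  evaluate-rest  : ∀ H → HereditarilySN (H ▷ N ⨾ M) → PerpetuallyEvaluates M

  evaluate {M = M} h with spine M
  evaluate (hsn _ sub) | at-pop =
    let _ , n , e = evaluate (sub body) in _ , pop n , normal-pop e
  evaluate h | at-beta H =
    let _ , n , e = evaluate-reduct h (▷-⟶ H beta)
        _ , _ , e′ = evaluate-arg H h
    in _ , n , beta {H = H} e e′
  evaluate h | at-redex H r expand =
    let _ , n , e = evaluate-reduct h (▷-⟶ H r) in _ , n , expand H e
  evaluate h | at-unit H =
    let _ , ns , es = evaluate-pushes H h
    in _ , neutral (neutral-▷ ns unit) , normal-unit es
  evaluate h | at-var H =
    let _ , ns , es = evaluate-pushes H h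
    in _ , neutral (neutral-▷ ns var) , normal-var es
  evaluate h | at-seq H =
    let _ , ns , es = evaluate-pushes H h
        _ , n , e = evaluate-rest H h
    in _ , neutral (neutral-▷ ns (seq n)) , normal-seq es e

  evaluate-reduct (hsn red _) r = evaluate (red r)

  evaluate-pushes []      h           = [] , [] , []
  evaluate-pushes (_ ∷ H) (hsn _ sub) =
    let _ , n , e = evaluate (sub arg)
        _ , ns , es = evaluate-pushes H (sub push)
    in _ , n ∷ ns , e ∷ es

  evaluate-arg []      (hsn _ sub) = evaluate (sub arg)
  evaluate-arg (_ ∷ H) (hsn _ sub) = evaluate-arg H (sub push)

  evaluate-rest []      (hsn _ sub) = evaluate (sub rest)
  evaluate-rest (_ ∷ H) (hsn _ sub) = evaluate-rest H (sub push)

  SN⇒evaluates : StronglyNormalizing M → PerpetuallyEvaluates M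
  SN⇒evaluates = evaluate ∘ SN⇒hsn

-- Equivalence of types, inversion of typings, and subject expansion.

module SubjectExpansion (A : Locations) where
  open FMC A

  private variable
    m n             : ℕ
    a b             : Location
    M M′ N P 𝓜      : Term n
    H 𝓗             : Pushes n
    τ τ′            : Computation
    ι ι′ κ κ′ μ     : Collection
    I K K′ L        : Memory
    Γ Γ′ Δ Δ′ E     : Context n

  ≈-refl   : ∀ τ → τ ≈ τ
  ≈ᵖ-refl  : ∀ ι → Pointwise _≈_ ι ι
  ≈ᵛ-refl  : ∀ κ → Pointwise _≈ᶜ_ κ κ

  ≈-refl (I ⇒ K) = (λ a → ≈ᵛ-refl (I a)) ⇒ (λ a → ≈ᵛ-refl (K a))
  ≈ᵖ-refl []      = []
  ≈ᵖ-refl (τ ∷ ι) = ≈-refl τ ∷ ≈ᵖ-refl ι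
  ≈ᵛ-refl []      = []
  ≈ᵛ-refl (ι ∷ κ) = Permutation.refl (≈ᵖ-refl ι) ∷ ≈ᵛ-refl κ

  ≈-sym  : τ ≈ τ′ → τ′ ≈ τ
  ≈ᵖ-sym : Pointwise _≈_ ι ι′ → Pointwise _≈_ ι′ ι
  ≈ᶜ-sym : ι ≈ᶜ ι′ → ι′ ≈ᶜ ι
  ≈ᵛ-sym : ∀ {κ κ′} → Pointwise _≈ᶜ_ κ κ′ → Pointwise _≈ᶜ_ κ′ κ

  ≈-sym (I≈ ⇒ K≈) = (λ a → ≈ᵛ-sym (I≈ a)) ⇒ (λ a → ≈ᵛ-sym (K≈ a))
  ≈ᵖ-sym []       = []
  ≈ᵖ-sym (p ∷ ps) = ≈-sym p ∷ ≈ᵖ-sym ps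
  ≈ᶜ-sym (Permutation.refl ps)     = Permutation.refl (≈ᵖ-sym ps)
  ≈ᶜ-sym (Permutation.prep p ps)   = Permutation.prep (≈-sym p) (≈ᶜ-sym ps)
  ≈ᶜ-sym (Permutation.swap p q ps) = Permutation.swap (≈-sym q) (≈-sym p) (≈ᶜ-sym ps)
  ≈ᶜ-sym (Permutation.trans ps qs) = Permutation.trans (≈ᶜ-sym qs) (≈ᶜ-sym ps)
  ≈ᵛ-sym []       = []
  ≈ᵛ-sym (p ∷ ps) = ≈ᶜ-sym p ∷ ≈ᵛ-sym ps

  ≈-trans : ∀ {τ τ′ τ″} → τ ≈ τ′ → τ′ ≈ τ″ → τ ≈ τ″
  ≈-trans (I≈ ⇒ K≈) (I≈′ ⇒ K≈′) =
    (λ a → Pointwise.transitive Permutation.trans (I≈ a) (I≈′ a)) ⇒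
    (λ a → Pointwise.transitive Permutation.trans (K≈ a) (K≈′ a))

  computationSetoid : Setoid 0ℓ 0ℓ
  computationSetoid = record
    { Carrier = Computation ; _≈_ = _≈_
    ; isEquivalence = record { refl = ≈-refl _ ; sym = ≈-sym ; trans = ≈-trans } }

  open PermutationSetoid computationSetoid using (↭-refl; ↭-sym; ↭-trans)
  open PermutationProperties computationSetoid 
    using (++⁺; ++⁺ʳ; ++-assoc; ++-comm; ++-identityʳ; ++-commutativeMonoid)
  open CommutativeSemigroupProperties (CommutativeMonoid.commutativeSemigroup ++-commutativeMonoid)
    using (interchange)

  infix 4 _≤ᶜ_ _≼_

  _≤ᶜ_ : Collection → Collection → Set
  ι ≤ᶜ κ = ∃ λ μ → ι ++ μ ≈ᶜ κ

  ≈⇒≤ᶜ : ι ≈ᶜ κ → ι ≤ᶜ κ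
  ≈⇒≤ᶜ p = [] , ↭-trans (++-identityʳ _) p

  ≤ᶜ-trans : ι ≤ᶜ κ → κ ≤ᶜ μ → ι ≤ᶜ μ
  ≤ᶜ-trans {ι} (μ₁ , p) (μ₂ , q) =
    μ₁ ++ μ₂ , ↭-trans (↭-sym (++-assoc ι μ₁ μ₂)) (↭-trans (++⁺ʳ μ₂ p) q)

  []≤ᶜ : [] ≤ᶜ ι
  []≤ᶜ {ι} = ι , ↭-refl

  ++-mono : ι ≤ᶜ κ → ι′ ≤ᶜ κ′ → ι ++ ι′ ≤ᶜ κ ++ κ′
  ++-mono {ι} {ι′ = ι′} (μ , p) (μ′ , q) =
    μ ++ μ′ , ↭-trans (interchange ι ι′ μ μ′) (++⁺ p q)

  ≤ᶜ-++ˡ : ι ≤ᶜ ι ++ κ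
  ≤ᶜ-++ˡ = _ , ↭-refl

  ≤ᶜ-++ʳ : ∀ ι → κ ≤ᶜ ι ++ κ
  ≤ᶜ-++ʳ {κ} ι = ι , ++-comm κ ι

  -- The freedom that weakening and conversion give to contexts. Inversion is stated up to it, since
  -- these rules may end any derivation.
  _≼_ : Context n → Context n → Set
  Γ ≼ Δ = ∀ x → Γ x ≤ᶜ Δ x

  ≼-refl : Γ ≼ Γ
  ≼-refl x = ≈⇒≤ᶜ ↭-refl

  ≼-trans : Γ ≼ Δ → Δ ≼ E → Γ ≼ E
  ≼-trans p q x = ≤ᶜ-trans (p x) (q x)

  weaken-≼ : Γ ≼ Δ → Γ ⊢ₛ M ∶ τ → Δ ⊢ₛ M ∶ τ
  weaken-≼ p d = conv (λ x → proj₂ (p x)) (≈-refl _) (weakening {Δ = λ x → proj₁ (p x)} d)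

  conv-type : τ ≈ τ′ → Γ ⊢ₛ M ∶ τ → Γ ⊢ₛ M ∶ τ′
  conv-type = conv (λ _ → ↭-refl)

  -- A bound variable may be given more types than the body uses. This keeps the type of an
  -- abstraction fixed when strengthening or antisubstitution shrinks the context of its body.
  pop-intro : ∀ {Γ : Context (suc n)} → Γ zero ≤ᶜ ι → Γ ⊢ₛ M ∶ K ⇒ L →
              Γ ∘ suc ⊢ₛ a ⟨⟩∙ M ∶ (K · ι at a) ⇒ L
  pop-intro {Γ = Γ} p d = abstraction (weaken-≼ (λ { zero → p ; (suc x) → ≼-refl {Γ = Γ} (suc x) }) d)

  ·-≈ : (∀ a → Pointwise _≈ᶜ_ (K a) (K′ a)) → ι ≈ᶜ ι′ → ∀ a b →
        Pointwise _≈ᶜ_ ((K · ι at a) b) ((K′ · ι′ at a) b)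
  ·-≈ K≈ ι≈ a b with does (a ≟ b)
  ... | true  = ι≈ ∷ K≈ b
  ... | false = K≈ b

  ·-comm : ∀ (K : Memory) {ι κ a b} → a ≢ b → ∀ c →
           Pointwise _≈ᶜ_ ((K · κ at b · ι at a) c) ((K · ι at a · κ at b) c)
  ·-comm K {a = a} {b} a≢b c with a ≟ c
  ... | yes refl rewrite dec-true (a ≟ a) refl | dec-false (b ≟ a) (a≢b ∘ sym) = ≈ᵛ-refl _
  ... | no a≢c rewrite dec-false (a ≟ c) a≢c = ≈ᵛ-refl _

  record PushTyping (Γ : Context n) (N : Term n) (a : Location) (M : Term n) (K L : Memory) : Set where
    constructor push-typing
    field
      {argContext bodyContext witnessContext} : Context n
      {argType}     : Collection
      {witnessType} : Computation
      arg           : argContext ⊢ₛᶜ N ∶ argType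
      body          : bodyContext ⊢ₛ M ∶ (K · argType at a) ⇒ L
      witness       : witnessContext ⊢ₛ N ∶ witnessType
      context       : argContext ⊕ bodyContext ⊕ witnessContext ≼ Γ

  record SeqTyping (Γ : Context n) (N M : Term n) (I L : Memory) : Set where
    constructor seq-typing
    field
      {leftContext rightContext} : Context n
      {middle} : Memory
      left     : leftContext ⊢ₛ N ∶ I ⇒ middle
      right    : rightContext ⊢ₛ M ∶ middle ⇒ L
      context  : leftContext ⊕ rightContext ≼ Γ

  -- The type is recovered only up to `≈`: the input memory of an abstraction is a computed
  -- function, which conversion may change pointwise.
  record PopTyping (Γ : Context n) (a : Location) (M : Term (suc n)) (τ : Computation) : Set where
    constructor pop-typing
    field
      {bodyContext}  : Context n
      {argType}      : Collection
      {input output} : Memory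
      body           : bodyContext ▹ argType ⊢ₛ M ∶ input ⇒ output
      type           : (input · argType at a) ⇒ output ≈ τ
      context        : bodyContext ≼ Γ

  ⊕-≼ˡ : Γ ⊕ Δ ≼ E → Γ ≼ E
  ⊕-≼ˡ p = ≼-trans (λ _ → ≤ᶜ-++ˡ) p

  ⊕-≼ʳ : ∀ Γ → Γ ⊕ Δ ≼ E → Δ ≼ E
  ⊕-≼ʳ Γ p = ≼-trans (λ x → ≤ᶜ-++ʳ (Γ x)) p

  ↦-≈ : ∀ {x : Fin n} → τ ≈ τ′ → ∀ y → (x ↦ τ) y ≈ᶜ (x ↦ τ′) y
  ↦-≈ {x = x} p y with x Fin.≟ y
  ... | yes _ = Permutation.prep p ↭-refl
  ... | no  _ = ↭-refl

  ≈-≼ : (∀ x → Γ x ≈ᶜ Δ x) → Γ ≼ Δ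
  ≈-≼ p x = ≈⇒≤ᶜ (p x)

  var⁻¹ : ∀ {x} → Γ ⊢ₛ var x ∶ τ → (x ↦ τ) ≼ Γ
  var⁻¹ variable′      = ≼-refl
  var⁻¹ (weakening d)  = ≼-trans (var⁻¹ d) (λ _ → ≤ᶜ-++ˡ)
  var⁻¹ {x = x} (conv Γ≈ τ≈ d) = ≼-trans (≈-≼ (↦-≈ {x = x} (≈-sym τ≈))) (≼-trans (var⁻¹ d) (≈-≼ Γ≈))

  unit⁻¹ : Γ ⊢ₛ ⋆ ∶ τ → ∅ {n} ⊢ₛ ⋆ ∶ τ
  unit⁻¹ unit           = unit
  unit⁻¹ (weakening d)  = unit⁻¹ d
  unit⁻¹ (conv _ τ≈ d)  = conv-type τ≈ (unit⁻¹ d)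

  pop⁻¹ : Γ ⊢ₛ a ⟨⟩∙ M ∶ τ → PopTyping Γ a M τ
  pop⁻¹ (abstraction d)  = pop-typing d (≈-refl _) ≼-refl
  pop⁻¹ (weakening d)    = let pop-typing dM τ≈′ p = pop⁻¹ d in
    pop-typing dM τ≈′ (≼-trans p (λ _ → ≤ᶜ-++ˡ))
  pop⁻¹ (conv Γ≈ τ≈ d)   = let pop-typing dM τ≈′ p = pop⁻¹ d in
    pop-typing dM (≈-trans τ≈′ τ≈) (≼-trans p (≈-≼ Γ≈))

  push⁻¹ : Γ ⊢ₛ [ N ] a ∙ M ∶ K ⇒ L → PushTyping Γ N a M K L
  push⁻¹ (strong-application dN dM d)  = push-typing dN dM d ≼-refl
  push⁻¹ (weakening d)                 = let push-typing dN dM d′ p = push⁻¹ d in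
    push-typing dN dM d′ (≼-trans p (λ _ → ≤ᶜ-++ˡ))
  push⁻¹ {a = a} (conv Γ≈ (K≈ ⇒ L≈) d) = let push-typing dN dM d′ p = push⁻¹ d in
    push-typing dN (conv-type (·-≈ K≈ ↭-refl a ⇒ L≈) dM) d′ (≼-trans p (≈-≼ Γ≈))

  seq⁻¹ : Γ ⊢ₛ N ⨾ M ∶ I ⇒ L → SeqTyping Γ N M I L
  seq⁻¹ (sequencing dN dM)       = seq-typing dN dM ≼-refl
  seq⁻¹ (weakening d)            = let seq-typing dN dM p = seq⁻¹ d in
    seq-typing dN dM (≼-trans p (λ _ → ≤ᶜ-++ˡ))
  seq⁻¹ (conv Γ≈ (I≈ ⇒ L≈) d)    = let seq-typing {middle = J} dN dM p = seq⁻¹ d in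
    seq-typing (conv-type (I≈ ⇒ λ a → ≈ᵛ-refl (J a)) dN)
               (conv-type ((λ a → ≈ᵛ-refl (J a)) ⇒ L≈) dM) (≼-trans p (≈-≼ Γ≈))

  -- Inversion discards weakenings, so the new context keeps only types that `M` uses. For `suc`
  -- this undoes `weaken`.
  strengthen  : ∀ (ρ : Fin m → Fin n) M → Γ ⊢ₛ rename ρ M ∶ τ →
                ∃ λ Γ′ → Γ′ ⊢ₛ M ∶ τ × Γ′ ≼ Γ ∘ ρ
  strengthenᶜ : ∀ (ρ : Fin m → Fin n) M → Γ ⊢ₛᶜ rename ρ M ∶ ι →
                ∃ λ Γ′ → Γ′ ⊢ₛᶜ M ∶ ι × Γ′ ≼ Γ ∘ ρ

  strengthen {Γ = Γ} {τ} ρ (var x) d = x ↦ τ , variable′ , below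
    where
    below : (x ↦ τ) ≼ Γ ∘ ρ
    below y with x Fin.≟ y
    ... | no _ = []≤ᶜ
    ... | yes refl with ρ x Fin.≟ ρ x | var⁻¹ d (ρ x)
    ...   | yes _ | p = p
    ...   | no ≢  | _ = contradiction refl ≢
  strengthen ρ (a ⟨⟩∙ M) d with pop⁻¹ d
  ... | pop-typing dM τ≈ p with strengthen (lift 1 ρ) M dM
  ...   | Γ′ , dM′ , q = Γ′ ∘ suc , conv-type τ≈ (pop-intro (q zero) dM′) ,
          λ x → ≤ᶜ-trans (q (suc x)) (p (ρ x))
  strengthen {τ = _ ⇒ _} ρ ([ N ] a ∙ M) d with push⁻¹ d
  ... | push-typing dN dM d′ p with strengthenᶜ ρ N dN | strengthen ρ M dM | strengthen ρ N d′
  ...   | Γₙ , dN′ , q | Γₘ , dM′ , r | Γₐ , d″ , s =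
    Γₙ ⊕ Γₘ ⊕ Γₐ , strong-application dN′ dM′ d″ ,
    λ x → ≤ᶜ-trans (++-mono (++-mono (q x) (r x)) (s x)) (p (ρ x))
  strengthen ρ ⋆ d = ∅ , unit⁻¹ d , λ x → []≤ᶜ
  strengthen {τ = _ ⇒ _} ρ (N ⨾ M) d with seq⁻¹ d
  ... | seq-typing dN dM p with strengthen ρ N dN | strengthen ρ M dM
  ...   | Γₙ , dN′ , q | Γₘ , dM′ , r =
    Γₙ ⊕ Γₘ , sequencing dN′ dM′ , λ x → ≤ᶜ-trans (++-mono (q x) (r x)) (p (ρ x))

  strengthenᶜ ρ M []       = ∅ , [] , λ _ → []≤ᶜ
  strengthenᶜ ρ M (d ∷ ds) with strengthen ρ M d | strengthenᶜ ρ M ds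
  ... | Γ , d′ , p | Δ , ds′ , q = Γ ⊕ Δ , d′ ∷ ds′ , λ x → ++-mono (p x) (q x)
  strengthenᶜ ρ M (conv Γ≈ ι≈ d) with strengthenᶜ ρ M d
  ... | Γ , d′ , p = Γ , conv (λ _ → ↭-refl) ι≈ d′ , ≼-trans p (≈-≼ (Γ≈ ∘ ρ))

  CollectionTypeable : Term n → Collection → Set
  CollectionTypeable M ι = ∃ λ Γ → Γ ⊢ₛᶜ M ∶ ι

  typeable-++ : Γ ⊢ₛᶜ M ∶ ι → CollectionTypeable M κ → CollectionTypeable M (ι ++ κ)
  typeable-++ [] e = e
  typeable-++ (d ∷ ds) e = let _ , es = typeable-++ ds e in _ , d ∷ es
  typeable-++ (conv _ ι≈ d) e =
    let _ , es = typeable-++ d e in _ , conv (λ _ → ↭-refl) (++⁺ʳ _ ι≈) es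

  -- Γ assigns types to the arguments of σ.  A variable y = σ x must not be used
  -- at more types than Δ provides; for other arguments it suffices that they have
  -- the types required in some context.
  record Instantiates (σ : Fin m → Term n) (Γ : Context m) (Δ : Context n) : Set where
    constructor instantiates
    field
      typeable : ∀ x → CollectionTypeable (σ x) (Γ x)
      below    : ∀ {x y} → σ x ≡ var y → Γ x ≤ᶜ Δ y
  open Instantiates

  instantiates-∅ : {σ : Fin m → Term n} → Instantiates σ ∅ Δ
  instantiates-∅ = instantiates (λ _ → ∅ , []) (λ _ → []≤ᶜ)

  instantiates-⊕ : {σ : Fin m → Term n} → Instantiates σ Γ Δ → Instantiates σ Γ′ Δ′ →
                   Instantiates σ (Γ ⊕ Γ′) (Δ ⊕ Δ′)
  instantiates-⊕ i j = instantiates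
    (λ x → typeable-++ (proj₂ (typeable i x)) (typeable j x))
    (λ eq → ++-mono (below i eq) (below j eq))

  instantiates-≼ : {σ : Fin m → Term n} → Instantiates σ Γ Δ → Δ ≼ Δ′ → Instantiates σ Γ Δ′
  instantiates-≼ i p = instantiates (typeable i) (λ {_} {y} eq → ≤ᶜ-trans (below i eq) (p y))

  -- At each occurrence of a variable `x` in `M`, the derivation for `σ x` is set aside as one
  -- member of the collection assigned to `x`; contexts are then rebuilt from these leaves.
  antisubstitute  : ∀ (σ : Fin m → Term n) M → Δ ⊢ₛ substitute σ M ∶ τ →
                    ∃ λ Γ → Γ ⊢ₛ M ∶ τ × Instantiates σ Γ Δ
  antisubstituteᶜ : ∀ (σ : Fin m → Term n) M → Δ ⊢ₛᶜ substitute σ M ∶ ι →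
                    ∃ λ Γ → Γ ⊢ₛᶜ M ∶ ι × Instantiates σ Γ Δ

  antisubstitute {Δ = Δ} {τ} σ (var x) d = x ↦ τ , variable′ , instantiates typ bel
    where
    typ : ∀ y → CollectionTypeable (σ y) ((x ↦ τ) y)
    typ y with x Fin.≟ y
    ... | yes refl = _ , d ∷ []
    ... | no _     = _ , []
    bel : ∀ {y z} → σ y ≡ var z → (x ↦ τ) y ≤ᶜ Δ z
    bel {y} {z} eq with x Fin.≟ y
    ... | no _ = []≤ᶜ
    ... | yes refl with σ x | eq
    ...   | _ | refl with z Fin.≟ z | var⁻¹ d z
    ...     | yes _ | p = p
    ...     | no ≢  | _ = contradiction refl ≢
  antisubstitute σ (a ⟨⟩∙ M) d with pop⁻¹ d
  ... | pop-typing dM τ≈ p with antisubstitute (liftₛ σ) M dM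
  -- As `liftₛ σ` fixes `zero`, `below` bounds the uses of the bound variable by its type in the
  -- abstraction. Derivations collected for the other variables live under the binder and are
  -- strengthened out of it.
  ...   | Γ , dM′ , i = Γ ∘ suc , conv-type τ≈ (pop-intro (below i refl) dM′) ,
    instantiates
      (λ x → let _ , e , _ = strengthenᶜ suc (σ x) (proj₂ (typeable i (suc x))) in _ , e)
      (λ {_} {y} eq → ≤ᶜ-trans (below i (cong weaken eq)) (p y))
  antisubstitute {τ = _ ⇒ _} σ ([ N ] a ∙ M) d with push⁻¹ d
  ... | push-typing dN dM d′ p with antisubstituteᶜ σ N dN
      | antisubstitute σ M dM | antisubstitute σ N d′
  ...   | _ , dN′ , i | _ , dM′ , j | _ , d″ , k =
    _ , strong-application dN′ dM′ d″ , instantiates-≼ (instantiates-⊕ (instantiates-⊕ i j) k) p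
  antisubstitute σ ⋆ d = ∅ , unit⁻¹ d , instantiates-∅
  antisubstitute {τ = _ ⇒ _} σ (N ⨾ M) d with seq⁻¹ d
  ... | seq-typing dN dM p with antisubstitute σ N dN | antisubstitute σ M dM
  ...   | _ , dN′ , i | _ , dM′ , j =
    _ , sequencing dN′ dM′ , instantiates-≼ (instantiates-⊕ i j) p

  antisubstituteᶜ σ M []       = ∅ , [] , instantiates-∅
  antisubstituteᶜ σ M (d ∷ ds) with antisubstitute σ M d | antisubstituteᶜ σ M ds
  ... | _ , d′ , i | _ , ds′ , j = _ , d′ ∷ ds′ , instantiates-⊕ i j
  antisubstituteᶜ σ M (conv Γ≈ ι≈ d) with antisubstituteᶜ σ M d
  ... | _ , d′ , i = _ , conv (λ _ → ↭-refl) ι≈ d′ , instantiates-≼ i (≈-≼ Γ≈)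

  -- Contexts may change freely: an abstraction fixes the types of its variable in
  -- its own type, and the types of free variables do not matter for typeability.
  Expands : Term n → Term n → Set
  Expands M′ M = ∀ {Γ I K} → Γ ⊢ₛ M′ ∶ I ⇒ K → ∃ λ Δ → Δ ⊢ₛ M ∶ I ⇒ K

  -- Expansion keeps both memories unchanged, so the new typing of the body still fits the push.
  expand-▷ : ∀ (H : Pushes n) → Expands M′ M → Expands (H ▷ M′) (H ▷ M)
  expand-▷ []            e d = e d
  expand-▷ ((N , a) ∷ H) e d =
    let push-typing dN dM d′ _ = push⁻¹ d
        _ , dM′ = expand-▷ H e dM
    in _ , strong-application dN dM′ d′

  -- `N` is pushed at the collection gathered for `zero`. That collection may be empty, so the extra
  -- premise of the rule is met by `dN`.
  expand-beta : Γ ⊢ₛ N ∶ τ → Expands (⟪ N ⟫ M) ([ N ] a ∙ (a ⟨⟩∙ M))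
  expand-beta {M = M} dN d =
    let _ , dM , i = antisubstitute _ M d
        _ , dNs = typeable i zero
    in _ , strong-application dNs (pop-intro (≈⇒≤ᶜ ↭-refl) dM) dN

  expand-passage : a ≢ b → Expands (a ⟨⟩∙ ([ weaken N ] b ∙ M)) ([ N ] b ∙ (a ⟨⟩∙ M))
  expand-passage {b = b} {N = N} {M = M} a≢b d with pop⁻¹ d
  ... | pop-typing {input = K} {L} dP (K≈ ⇒ L≈) _ with push⁻¹ dP
  ...   | push-typing {argContext} dN dM d′ p with strengthenᶜ suc N dN | strengthen suc N d′
  ...     | _ , eN , _ | _ , e′ , _ = _ , strong-application eN
    (conv-type
      -- The push and the pop concern distinct locations, so their entries can be exchanged in the
      -- input memory.
      ((λ c → Pointwise.transitive Permutation.trans (·-comm K a≢b c) (·-≈ K≈ ↭-refl b c)) ⇒ L≈)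
      (pop-intro (⊕-≼ʳ argContext (⊕-≼ˡ p) zero) dM)) e′

  expand-next : Expands M (⋆ ⨾ M)
  expand-next d = _ , sequencing unit d

  expand-prefix-pop : Expands (a ⟨⟩∙ (N ⨾ weaken M)) ((a ⟨⟩∙ N) ⨾ M)
  expand-prefix-pop {M = M} d with pop⁻¹ d
  ... | pop-typing dP (K≈ ⇒ L≈) _ with seq⁻¹ dP
  ...   | seq-typing {leftContext} {middle = J} dN dM p with strengthen suc M dM
  ...     | _ , dM′ , _ = _ , sequencing
    (conv-type (K≈ ⇒ λ a → ≈ᵛ-refl (J a)) (pop-intro (⊕-≼ˡ {Γ = leftContext} p zero) dN))
    (conv-type ((λ a → ≈ᵛ-refl (J a)) ⇒ L≈) dM′)

  expand-prefix-push : Expands ([ P ] a ∙ (N ⨾ M)) (([ P ] a ∙ N) ⨾ M)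
  expand-prefix-push d =
    let push-typing dP d′ e _ = push⁻¹ d
        seq-typing dN dM _ = seq⁻¹ d′
    in _ , sequencing (strong-application dP dN e) dM

  expand-associate : Expands (P ⨾ (N ⨾ M)) ((P ⨾ N) ⨾ M)
  expand-associate d =
    let seq-typing dP d′ _ = seq⁻¹ d
        seq-typing dN dM _ = seq⁻¹ d′
    in _ , sequencing (sequencing dP dN) dM

  -- All input memories are considered because each push, with its argument at the empty collection,
  -- extends the memory that the rest must accept. Evaluation of the argument supplies the witness
  -- typing.
  typeable-▷ : H ▶* 𝓗 → (∀ I → ∃₂ λ Γ K → Γ ⊢ₛ M ∶ I ⇒ K) →
               ∀ I → ∃₂ λ Γ K → Γ ⊢ₛ H ▷ M ∶ I ⇒ K
  evaluates⇒typeable : M ▶ 𝓜 → StronglyTypeable M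

  expanded : ∀ (H : Pushes n) → Expands M′ M → StronglyTypeable (H ▷ M′) → StronglyTypeable (H ▷ M)
  expanded H e (_ , _ ⇒ _ , d) = let _ , d′ = expand-▷ H e d in _ , _ , d′

  typeable-▷ []       h I = h I
  typeable-▷ (_∷_ {a = a} e es) h I =
    let _ , _ , dN = evaluates⇒typeable e
        _ , _ , dM = typeable-▷ es h (I · [] at a)
    in _ , _ , strong-application [] dM dN

  typeable-from-[] : (∀ I → ∃₂ λ Γ K → Γ ⊢ₛ M ∶ I ⇒ K) → StronglyTypeable M
  typeable-from-[] h = let Γ , K , d = h (λ _ → []) in Γ , _ , d

  evaluates⇒typeable (beta {H = H} e e′)         =
    let _ , _ , dN = evaluates⇒typeable e′
    in expanded H (expand-beta dN) (evaluates⇒typeable e)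
  evaluates⇒typeable (passage {H = H} a≢b e)     = expanded H (expand-passage a≢b) (evaluates⇒typeable e)
  evaluates⇒typeable (next {H = H} e)            = expanded H expand-next (evaluates⇒typeable e)
  evaluates⇒typeable (prefix-pop {H = H} e)      = expanded H expand-prefix-pop (evaluates⇒typeable e)
  evaluates⇒typeable (prefix-push {H = H} e)     = expanded H expand-prefix-push (evaluates⇒typeable e)
  evaluates⇒typeable (associate {H = H} e)       = expanded H expand-associate (evaluates⇒typeable e)
  evaluates⇒typeable (normal-pop e) with evaluates⇒typeable e
  ... | _ , _ ⇒ _ , d = _ , _ , pop-intro (≈⇒≤ᶜ ↭-refl) d
  evaluates⇒typeable (normal-unit es)            = typeable-from-[] (typeable-▷ es (λ I → _ , I , unit))
  evaluates⇒typeable (normal-var es)             = typeable-from-[] (typeable-▷ es (λ I → _ , I , variable′))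
  evaluates⇒typeable (normal-seq es e) with evaluates⇒typeable e
  -- The head variable can take any type, so its output memory is chosen to be the input of the
  -- continuation.
  ... | _ , _ ⇒ _ , d = typeable-from-[] (typeable-▷ es (λ I → _ , _ , sequencing variable′ d))

-- Closing the cycle of implications.

theorem29 : (A : Locations) → let open FMC A in (n : ℕ) (M : Term n) →
    (StronglyTypeable M ⇔ StronglyNormalizing M) ×
    (StronglyNormalizing M ⇔ PerpetuallyEvaluates M)
theorem29 A n M =
  mk⇔ typeable⇒SN (evaluates⇒typeable ∘ evaluation ∘ SN⇒evaluates) ,
  mk⇔ SN⇒evaluates (typeable⇒SN ∘ evaluates⇒typeable ∘ evaluation)
  where
  open FMC A
  open Reducibility A
  open Evaluation A
  open SubjectExpansion A

  evaluation : (e : PerpetuallyEvaluates M) → M ▶ proj₁ e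
  evaluation (_ , _ , e) = e
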